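{- For all $\Delta\geq 9$ and $\epsilon>0$, and for all sufficiently large $n>n(\Delta,\epsilon)$, there exists a $\Delta$-regular $n$-vertex graph $G$ with slope parameter $$\mathsf{sl}(G)>\tfrac{1}{4}\bigl((1-\epsilon)\Delta-8\bigr)n.$$
   Context: Graphs are undirected, finite and simple. For a set $P\subseteq\mathbb{R}^2$ of points in the plane and a set $S\subset\mathbb{R}\cup\{\infty\}$ of slopes, $G(P,S)$ is the graph with vertex set $P$ in which two distinct points $v,w\in P$ are adjacent if and only if the slope of the line $\overline{vw}$ is in $S$. The slope parameter $\mathsf{sl}(G)$ of a graph $G$ is the minimum integer $k$ such that $G\cong G(P,S)$ for some point set $P$ and slope set $S$ with $|S|=k$. Here $\Delta$ and $n$ are integers, and $n(\Delta,\epsilon)$ denotes a threshold depending only on $\Delta$ and $\epsilon$.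
   Formalization: The formal theorem is stated only for those n for which Δn is even; when Δn is odd (for example Δ = 9 and n odd) no Δ-regular n-vertex graph exists, so the statement fails there as written. -}

module Defs where

open import Algebra.Properties.Group using (∙-cancelʳ)
open import Data.Fin.Base as Fin using (Fin; toℕ)
import Data.Fin.Properties as Fin
open import Data.Fin.Subset using (Subset; _∈_) renaming (∣_∣ to ∣_∣ₛ)
open import Data.Fin.Subset.Properties using (_∈?_)
open import Data.Integer.Base using (+_)
open import Data.List.Base as List using (List; length; allFin; cartesianProduct; filter)
import Data.List.Membership.Propositional as List
open import Data.List.Membership.Propositional.Properties
  using (∈-allFin; ∈-cartesianProduct⁺; ∈-filter⁺; ∈-filter⁻; ∈-lookup)
import Data.List.Relation.Unary.All as All
open import Data.List.Relation.Unary.AllPairs using (_∷_)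
open import Data.List.Relation.Unary.Any as Any using (index)
open import Data.List.Relation.Unary.Any.Properties using (lookup-index)
open import Data.List.Relation.Unary.Unique.Propositional using (Unique)
import Data.List.Relation.Unary.Unique.Propositional.Properties as Unique
open import Data.Nat.Base as ℕ using (ℕ; zero; suc)
import Data.Nat.Induction as ℕ
import Data.Nat.Properties as ℕ
open import Data.Product.Base using (Σ-syntax; ∃-syntax; _×_; _,_; proj₁; proj₂)
open import Data.Rational.Base as ℚ using (ℚ; 0ℚ; 1ℚ; ½; ∣_∣)
import Data.Rational.Properties as ℚ
open import Data.Rational.Solver using (module +-*-Solver)
open import Function.Base using (_∘_)
open import Function.Bundles using (_↔_; _⇔_; Inverse; mk⇔)
open import Function.Construct.Identity using (↔-id)
open import Function.Definitions using (Injective)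
open import Level using (0ℓ)
open import Relation.Binary.Core using (Rel)
open import Relation.Binary.Definitions using (Symmetric; Irreflexive; Decidable; tri<; tri≈; tri>)
open import Relation.Binary.PropositionalEquality.Core
  using (_≡_; _≢_; refl; sym; trans; cong; cong₂; subst)
open import Relation.Binary.PropositionalEquality.Properties using (module ≡-Reasoning)
open import Relation.Nullary.Decidable using (Dec; yes; no; map; _×-dec_)
open import Relation.Nullary.Negation using (¬_; contradiction)

private
  variable
    m n : ℕ

------------------------------------------------------------------------
-- Real numbers, as Cauchy sequences of rationals

IsCauchy : (ℕ → ℚ) → Set
IsCauchy a = ∀ {δ} → 0ℚ ℚ.< δ →
  ∃[ N ] (∀ {i j} → N ℕ.≤ i → N ℕ.≤ j → ∣ a i ℚ.- a j ∣ ℚ.< δ)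

record ℝ : Set where
  constructor mkℝ
  field
    seq    : ℕ → ℚ
    cauchy : IsCauchy seq

open ℝ

infix  4 _≈_ _<_
infix  8 -_
infixl 7 _*_
infixl 6 _+_ _-_

-- Records rather than plain function and Σ types, so that x and y can be inferred.
record _≈_ (x y : ℝ) : Set where
  constructor mk≈
  field
    close : ∀ {δ} → 0ℚ ℚ.< δ →
      ∃[ N ] (∀ {i} → N ℕ.≤ i → ∣ seq x i ℚ.- seq y i ∣ ℚ.< δ)

record _<_ (x y : ℝ) : Set where
  constructor mk<
  field
    gap       : ℚ
    gap>0     : 0ℚ ℚ.< gap
    separated : ∃[ N ] (∀ {i} → N ℕ.≤ i → seq x i ℚ.+ gap ℚ.≤ seq y i)

open _≈_

private abstract
  half-pos : ∀ {δ} → 0ℚ ℚ.< δ → 0ℚ ℚ.< δ ℚ.* ½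
  half-pos {δ} δ>0 = ℚ.positive⁻¹ (δ ℚ.* ½) {{ℚ.pos*pos⇒pos δ {{ℚ.positive δ>0}} ½}}

  half+half : ∀ δ → δ ℚ.* ½ ℚ.+ δ ℚ.* ½ ≡ δ
  half+half δ = trans (sym (ℚ.*-distribˡ-+ δ ½ ½)) (ℚ.*-identityʳ δ)

  const-cauchy : ∀ p → IsCauchy (λ _ → p)
  const-cauchy p {δ} δ>0 = 0 , λ _ _ → subst (λ z → ∣ z ∣ ℚ.< δ) (sym (ℚ.+-inverseʳ p)) δ>0

  +-cauchy : ∀ {a b} → IsCauchy a → IsCauchy b → IsCauchy (λ i → a i ℚ.+ b i)
  +-cauchy {a} {b} ca cb {δ} δ>0 with ca (half-pos δ>0) | cb (half-pos δ>0)
  ... | M , p | N , q = M ℕ.⊔ N , λ {i} {j} hi hj → begin-strict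
    ∣ (a i ℚ.+ b i) ℚ.- (a j ℚ.+ b j) ∣
      ≡⟨ cong ∣_∣ (solve 4 (λ s t u v → (s :+ t) :- (u :+ v) := (s :- u) :+ (t :- v)) refl
                     (a i) (b i) (a j) (b j)) ⟩
    ∣ (a i ℚ.- a j) ℚ.+ (b i ℚ.- b j) ∣
      ≤⟨ ℚ.∣p+q∣≤∣p∣+∣q∣ (a i ℚ.- a j) (b i ℚ.- b j) ⟩
    ∣ a i ℚ.- a j ∣ ℚ.+ ∣ b i ℚ.- b j ∣
      <⟨ ℚ.+-mono-< (p (ℕ.m⊔n≤o⇒m≤o M N hi) (ℕ.m⊔n≤o⇒m≤o M N hj))
                    (q (ℕ.m⊔n≤o⇒n≤o M N hi) (ℕ.m⊔n≤o⇒n≤o M N hj)) ⟩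
    δ ℚ.* ½ ℚ.+ δ ℚ.* ½
      ≡⟨ half+half δ ⟩
    δ ∎
    where open ℚ.≤-Reasoning
          open +-*-Solver

  neg-cauchy : ∀ {a} → IsCauchy a → IsCauchy (λ i → ℚ.- a i)
  neg-cauchy {a} ca {δ} δ>0 with ca δ>0
  ... | N , p = N , λ {i} {j} hi hj →
    subst (λ z → z ℚ.< δ)
      (trans (sym (ℚ.∣-p∣≡∣p∣ (a i ℚ.- a j))) (cong ∣_∣ (ℚ.neg-distrib-+ (a i) (ℚ.- a j))))
      (p hi hj)

  bounded : ∀ {a} → IsCauchy a →
    ∃[ B ] (0ℚ ℚ.< B × ∃[ N ] (∀ {i} → N ℕ.≤ i → ∣ a i ∣ ℚ.≤ B))
  bounded {a} ca with ca {1ℚ} (ℚ.positive⁻¹ 1ℚ)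
  ... | N , p = ∣ a N ∣ ℚ.+ 1ℚ
    , ℚ.+-mono-≤-< (ℚ.0≤∣p∣ (a N)) (ℚ.positive⁻¹ 1ℚ)
    , N , λ {i} hi → begin
    ∣ a i ∣
      ≡⟨ cong ∣_∣ (solve 2 (λ s t → s := t :+ (s :- t)) refl (a i) (a N)) ⟩
    ∣ a N ℚ.+ (a i ℚ.- a N) ∣
      ≤⟨ ℚ.∣p+q∣≤∣p∣+∣q∣ (a N) (a i ℚ.- a N) ⟩
    ∣ a N ∣ ℚ.+ ∣ a i ℚ.- a N ∣
      ≤⟨ ℚ.+-monoʳ-≤ ∣ a N ∣ (ℚ.<⇒≤ (p hi ℕ.≤-refl)) ⟩
    ∣ a N ∣ ℚ.+ 1ℚ ∎
    where open ℚ.≤-Reasoning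
          open +-*-Solver

  *-bound : ∀ {B δ} → 0ℚ ℚ.< B → ∀ p q → ∣ p ∣ ℚ.≤ B → ∣ q ∣ ℚ.< δ → ∣ p ℚ.* q ∣ ℚ.≤ B ℚ.* δ
  *-bound {B} {δ} B>0 p q hp hq = begin
    ∣ p ℚ.* q ∣       ≡⟨ ℚ.∣p*q∣≡∣p∣*∣q∣ p q ⟩
    ∣ p ∣ ℚ.* ∣ q ∣   ≤⟨ ℚ.*-monoʳ-≤-nonNeg ∣ q ∣ {{ℚ.∣-∣-nonNeg q}} hp ⟩
    B ℚ.* ∣ q ∣       ≤⟨ ℚ.*-monoˡ-≤-nonNeg B {{ℚ.nonNegative (ℚ.<⇒≤ B>0)}} (ℚ.<⇒≤ hq) ⟩
    B ℚ.* δ ∎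
    where open ℚ.≤-Reasoning

  scale : ∀ {C δ} → 0ℚ ℚ.< C → 0ℚ ℚ.< δ → ∃[ δ′ ] (0ℚ ℚ.< δ′ × C ℚ.* δ′ ℚ.< δ)
  scale {C} {δ} C>0 δ>0 = ℚ.1/ C ℚ.* (δ ℚ.* ½)
    , ℚ.positive⁻¹ _
        {{ℚ.pos*pos⇒pos (ℚ.1/ C) {{ℚ.1/pos⇒pos C}} (δ ℚ.* ½) {{ℚ.positive (half-pos δ>0)}}}}
    , (begin-strict
    C ℚ.* (ℚ.1/ C ℚ.* (δ ℚ.* ½))   ≡⟨ sym (ℚ.*-assoc C (ℚ.1/ C) (δ ℚ.* ½)) ⟩
    (C ℚ.* ℚ.1/ C) ℚ.* (δ ℚ.* ½)   ≡⟨ cong (ℚ._* (δ ℚ.* ½)) (ℚ.*-inverseʳ C) ⟩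
    1ℚ ℚ.* (δ ℚ.* ½)               ≡⟨ ℚ.*-identityˡ (δ ℚ.* ½) ⟩
    δ ℚ.* ½                        ≡⟨ sym (ℚ.+-identityʳ (δ ℚ.* ½)) ⟩
    δ ℚ.* ½ ℚ.+ 0ℚ                 <⟨ ℚ.+-monoʳ-< (δ ℚ.* ½) (half-pos δ>0) ⟩
    δ ℚ.* ½ ℚ.+ δ ℚ.* ½            ≡⟨ half+half δ ⟩
    δ                              ∎)
    where
    open ℚ.≤-Reasoning
    instance
      C-pos : ℚ.Positive C
      C-pos = ℚ.positive C>0
      C-nonZero : ℚ.NonZero C
      C-nonZero = ℚ.pos⇒nonZero C

  *-expand : ∀ s t u v → s ℚ.* t ℚ.- u ℚ.* v ≡ s ℚ.* (t ℚ.- v) ℚ.+ v ℚ.* (s ℚ.- u)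
  *-expand = solve 4 (λ s t u v → s :* t :- u :* v := s :* (t :- v) :+ v :* (s :- u)) refl
    where open +-*-Solver

  *-close : ∀ {A B δ} → 0ℚ ℚ.< A → 0ℚ ℚ.< B → ∀ s t u v →
    ∣ s ∣ ℚ.≤ A → ∣ v ∣ ℚ.≤ B → ∣ s ℚ.- u ∣ ℚ.< δ → ∣ t ℚ.- v ∣ ℚ.< δ →
    ∣ s ℚ.* t ℚ.- u ℚ.* v ∣ ℚ.≤ (A ℚ.+ B) ℚ.* δ
  *-close {A} {B} {δ} A>0 B>0 s t u v hs hv hsu htv = begin
    ∣ s ℚ.* t ℚ.- u ℚ.* v ∣
      ≡⟨ cong ∣_∣ (*-expand s t u v) ⟩
    ∣ s ℚ.* (t ℚ.- v) ℚ.+ v ℚ.* (s ℚ.- u) ∣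
      ≤⟨ ℚ.∣p+q∣≤∣p∣+∣q∣ (s ℚ.* (t ℚ.- v)) (v ℚ.* (s ℚ.- u)) ⟩
    ∣ s ℚ.* (t ℚ.- v) ∣ ℚ.+ ∣ v ℚ.* (s ℚ.- u) ∣
      ≤⟨ ℚ.+-mono-≤ (*-bound A>0 s (t ℚ.- v) hs htv) (*-bound B>0 v (s ℚ.- u) hv hsu) ⟩
    A ℚ.* δ ℚ.+ B ℚ.* δ
      ≡⟨ sym (ℚ.*-distribʳ-+ δ A B) ⟩
    (A ℚ.+ B) ℚ.* δ ∎
    where open ℚ.≤-Reasoning

  *-cauchy : ∀ {a b} → IsCauchy a → IsCauchy b → IsCauchy (λ i → a i ℚ.* b i)
  *-cauchy {a} {b} ca cb δ>0 =
    let A , A>0 , K , hA   = bounded ca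
        B , B>0 , L , hB   = bounded cb
        δ′ , δ′>0 , Cδ′<δ  = scale (ℚ.+-mono-< A>0 B>0) δ>0
        M , p              = ca δ′>0
        N , q              = cb δ′>0
        KL≤ : ∀ {i} → (K ℕ.⊔ L) ℕ.⊔ (M ℕ.⊔ N) ℕ.≤ i → K ℕ.⊔ L ℕ.≤ i
        KL≤ = ℕ.m⊔n≤o⇒m≤o (K ℕ.⊔ L) (M ℕ.⊔ N)
        MN≤ : ∀ {i} → (K ℕ.⊔ L) ℕ.⊔ (M ℕ.⊔ N) ℕ.≤ i → M ℕ.⊔ N ℕ.≤ i
        MN≤ = ℕ.m⊔n≤o⇒n≤o (K ℕ.⊔ L) (M ℕ.⊔ N)
    in (K ℕ.⊔ L) ℕ.⊔ (M ℕ.⊔ N) , λ {i} {j} hi hj → ℚ.≤-<-trans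
      (*-close A>0 B>0 (a i) (b i) (a j) (b j)
        (hA (ℕ.m⊔n≤o⇒m≤o K L (KL≤ hi)))
        (hB (ℕ.m⊔n≤o⇒n≤o K L (KL≤ hj)))
        (p (ℕ.m⊔n≤o⇒m≤o M N (MN≤ hi)) (ℕ.m⊔n≤o⇒m≤o M N (MN≤ hj)))
        (q (ℕ.m⊔n≤o⇒n≤o M N (MN≤ hi)) (ℕ.m⊔n≤o⇒n≤o M N (MN≤ hj))))
      Cδ′<δ

fromℚ : ℚ → ℝ
fromℚ p = mkℝ (λ _ → p) (const-cauchy p)

fromℕ : ℕ → ℝ
fromℕ n = fromℚ (+ n ℚ./ 1)

0ℝ 1ℝ : ℝ
0ℝ = fromℚ 0ℚ
1ℝ = fromℚ 1ℚ

_+_ _*_ : ℝ → ℝ → ℝ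
x + y = mkℝ (λ i → seq x i ℚ.+ seq y i) (+-cauchy {seq x} {seq y} (cauchy x) (cauchy y))
x * y = mkℝ (λ i → seq x i ℚ.* seq y i) (*-cauchy {seq x} {seq y} (cauchy x) (cauchy y))

-_ : ℝ → ℝ
- x = mkℝ (λ i → ℚ.- seq x i) (neg-cauchy {seq x} (cauchy x))

_-_ : ℝ → ℝ → ℝ
x - y = x + (- y)

------------------------------------------------------------------------
-- Graphs

record Graph (n : ℕ) : Set₁ where
  field
    _~_      : Rel (Fin n) 0ℓ
    ~-sym    : Symmetric _~_
    ~-irrefl : Irreflexive _≡_ _~_

Adjacent : Graph n → Rel (Fin n) 0ℓ
Adjacent = Graph._~_

infix 4 _≅_

_≅_ : Graph m → Graph n → Set
_≅_ {m} {n} G H = Σ[ f ∈ Fin m ↔ Fin n ]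
  (∀ v w → Adjacent G v w ⇔ Adjacent H (Inverse.to f v) (Inverse.to f w))

Regular : ℕ → Graph n → Set
Regular {n} Δ G = ∀ v → Σ[ N ∈ Subset n ] (∣ N ∣ₛ ≡ Δ × (∀ w → w ∈ N ⇔ Adjacent G v w))

------------------------------------------------------------------------
-- Slopes

Point : Set
Point = ℝ × ℝ

infix 4 _≈ₚ_ _≈ₛ_

_≈ₚ_ : Rel Point 0ℓ
(x , y) ≈ₚ (x′ , y′) = x ≈ x′ × y ≈ y′

data Slope : Set where
  finite : ℝ → Slope
  ∞      : Slope

data _≈ₛ_ : Rel Slope 0ℓ where
  finite : ∀ {r s} → r ≈ s → finite r ≈ₛ finite s
  ∞      : ∞ ≈ₛ ∞

-- HasSlope p q s: the line through the distinct points p and q has slope s.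
-- The equation (y′ - y) / (x′ - x) ≈ r is stated without division.
HasSlope : Point → Point → Slope → Set
HasSlope (x , y) (x′ , y′) (finite r) = ¬ x ≈ x′ × y′ - y ≈ r * (x′ - x)
HasSlope (x , y) (x′ , y′) ∞          = x ≈ x′

record PointSet (n : ℕ) : Set where
  field
    point    : Fin n → Point
    distinct : Injective _≡_ _≈ₚ_ point

record SlopeSet (k : ℕ) : Set where
  field
    slope    : Fin k → Slope
    distinct : Injective _≡_ _≈ₛ_ slope

open PointSet using (point)
open SlopeSet using (slope)

private
  ≡⇒≈ : ∀ {x y} → (∀ i → seq x i ≡ seq y i) → x ≈ y
  ≡⇒≈ {x} {y} h = mk≈ λ {δ} δ>0 → 0 , λ {i} _ →
    subst (λ z → ∣ z ∣ ℚ.< δ)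
      (trans (sym (ℚ.+-inverseʳ (seq x i))) (cong (λ q → seq x i ℚ.- q) (h i))) δ>0

  ∣-∣-flip : ∀ p q → ∣ p ℚ.- q ∣ ≡ ∣ q ℚ.- p ∣
  ∣-∣-flip p q = trans (sym (ℚ.∣-p∣≡∣p∣ (p ℚ.- q)))
    (cong ∣_∣ (solve 2 (λ s t → :- (s :- t) := t :- s) refl p q))
    where open +-*-Solver

  ≈-sym : Symmetric _≈_
  ≈-sym {x} {y} h = mk≈ λ {δ} δ>0 → let N , f = close h δ>0 in
    N , λ {i} hi → subst (ℚ._< δ) (∣-∣-flip (seq x i) (seq y i)) (f hi)

  slope-flip : ∀ a b a′ b′ c →
    ∣ (b′ ℚ.- b) ℚ.- c ℚ.* (a′ ℚ.- a) ∣ ≡ ∣ (b ℚ.- b′) ℚ.- c ℚ.* (a ℚ.- a′) ∣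
  slope-flip a b a′ b′ c = trans (sym (ℚ.∣-p∣≡∣p∣ ((b′ ℚ.- b) ℚ.- c ℚ.* (a′ ℚ.- a))))
    (cong ∣_∣ (solve 5 (λ a b a′ b′ c →
        :- ((b′ :- b) :- c :* (a′ :- a)) := (b :- b′) :- c :* (a :- a′)) refl a b a′ b′ c))
    where open +-*-Solver

  HasSlope-sym : ∀ p q s → HasSlope p q s → HasSlope q p s
  HasSlope-sym _ _ ∞ x≈x′ = ≈-sym x≈x′
  HasSlope-sym (x , y) (x′ , y′) (finite r) (x≉x′ , e) =
    (λ h → x≉x′ (≈-sym h)) , mk≈ λ {δ} δ>0 → let N , f = close e δ>0 in
      N , λ {i} hi → subst (ℚ._< δ)
        (slope-flip (seq x i) (seq y i) (seq x′ i) (seq y′ i) (seq r i)) (f hi)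

slopeGraph : ∀ {n k} → PointSet n → SlopeSet k → Graph n
slopeGraph P S = record
  { _~_      = λ v w → v ≢ w × ∃[ i ] HasSlope (point P v) (point P w) (slope S i)
  ; ~-sym    = λ {v} {w} (v≢w , i , h) →
      (v≢w ∘ sym) , i , HasSlope-sym (point P v) (point P w) (slope S i) h
  ; ~-irrefl = λ v≡w (v≢w , _) → v≢w v≡w
  }

Representable : Graph n → ℕ → Set
Representable G k = ∃[ m ] Σ[ P ∈ PointSet m ] Σ[ S ∈ SlopeSet k ] G ≅ slopeGraph P S

IsSlopeParameter : Graph n → ℕ → Set
IsSlopeParameter G k = Representable G k × (∀ j → Representable G j → k ℕ.≤ j)

------------------------------------------------------------------------
-- The slope parameter is well defined.  The double negation is needed because
-- choosing the least k is not effective; classically it can be dropped.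

private
  onParabola : ℚ → Point
  onParabola a = fromℚ a , fromℚ (a ℚ.* a)

private abstract
  least : ∀ {P : ℕ → Set} k → P k → ¬ ¬ (∃[ l ] (P l × (∀ j → P j → l ℕ.≤ j)))
  least {P} = ℕ.<-rec _ λ k rec pk none → none (k , pk , λ j pj →
    ℕ.≮⇒≥ λ j<k → rec j<k pj none)

  p-q≡0⇒p≡q : ∀ p q → p ℚ.- q ≡ 0ℚ → p ≡ q
  p-q≡0⇒p≡q p q e = trans (solve 2 (λ s t → s := (s :- t) :+ t) refl p q)
    (trans (cong (ℚ._+ q) e) (ℚ.+-identityˡ q))
    where open +-*-Solver

  fromℚ-injective : ∀ {p q} → fromℚ p ≈ fromℚ q → p ≡ q
  fromℚ-injective {p} {q} h with p ℚ.≟ q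
  ... | yes p≡q = p≡q
  ... | no  p≢q = contradiction (proj₂ (close h (pos p-q≢0)) ℕ.≤-refl) (ℚ.<-irrefl refl)
    where
    p-q≢0 : p ℚ.- q ≢ 0ℚ
    p-q≢0 e = p≢q (p-q≡0⇒p≡q p q e)
    pos : p ℚ.- q ≢ 0ℚ → 0ℚ ℚ.< ∣ p ℚ.- q ∣
    pos ne with ℚ.<-cmp 0ℚ ∣ p ℚ.- q ∣
    ... | tri< lt _ _ = lt
    ... | tri≈ _ eq _ = contradiction (ℚ.∣p∣≡0⇒p≡0 (p ℚ.- q) (sym eq)) ne
    ... | tri> _ _ gt = contradiction (ℚ.≤-<-trans (ℚ.0≤∣p∣ (p ℚ.- q)) gt) (ℚ.<-irrefl refl)

  *-zero-cancel : ∀ p q → p ≢ 0ℚ → p ℚ.* q ≡ 0ℚ → q ≡ 0ℚ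
  *-zero-cancel p q p≢0 e = begin
    q                        ≡⟨ sym (ℚ.*-identityˡ q) ⟩
    1ℚ ℚ.* q                 ≡⟨ cong (ℚ._* q) (sym (ℚ.*-inverseˡ p)) ⟩
    (ℚ.1/ p) ℚ.* p ℚ.* q     ≡⟨ ℚ.*-assoc (ℚ.1/ p) p q ⟩
    (ℚ.1/ p) ℚ.* (p ℚ.* q)   ≡⟨ cong ((ℚ.1/ p) ℚ.*_) e ⟩
    (ℚ.1/ p) ℚ.* 0ℚ          ≡⟨ ℚ.*-zeroʳ (ℚ.1/ p) ⟩
    0ℚ                       ∎
    where
    open ≡-Reasoning
    instance
      p-nonZero : ℚ.NonZero p
      p-nonZero = ℚ.≢-nonZero p≢0

  -- The points (2ⁱ , 4ⁱ) lie on a parabola and determine distinct slopes 2ⁱ + 2ʲ.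
  2^ : ℕ → ℚ
  2^ zero    = 1ℚ
  2^ (suc i) = 2^ i ℚ.+ 2^ i

  2^-pos : ∀ i → 0ℚ ℚ.< 2^ i
  2^-pos zero    = ℚ.positive⁻¹ 1ℚ
  2^-pos (suc i) = ℚ.+-mono-< (2^-pos i) (2^-pos i)

  2^-double : ∀ {i j} → i ℕ.<′ j → 2^ i ℚ.+ 2^ i ℚ.≤ 2^ j
  2^-double ℕ.<′-base = ℚ.≤-refl
  2^-double {i} {suc j} (ℕ.≤′-step i<j) = ℚ.≤-trans (2^-double i<j)
    (subst (ℚ._≤ 2^ j ℚ.+ 2^ j) (ℚ.+-identityˡ (2^ j))
      (ℚ.+-monoˡ-≤ (2^ j) (ℚ.<⇒≤ (2^-pos j))))

  2^-mono : ∀ {i j} → i ℕ.< j → 2^ i ℚ.< 2^ j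
  2^-mono {i} i<j = ℚ.<-≤-trans
    (subst (ℚ._< 2^ i ℚ.+ 2^ i) (ℚ.+-identityˡ (2^ i)) (ℚ.+-monoˡ-< (2^ i) (2^-pos i)))
    (2^-double (ℕ.<⇒<′ i<j))

  2^-injective : ∀ {i j} → 2^ i ≡ 2^ j → i ≡ j
  2^-injective {i} {j} e with ℕ.<-cmp i j
  ... | tri< lt _ _ = contradiction (2^-mono lt) (ℚ.<-irrefl e)
  ... | tri≈ _ eq _ = eq
  ... | tri> _ _ gt = contradiction (2^-mono gt) (ℚ.<-irrefl (sym e))

  sum-< : ∀ {i j k l} → i ℕ.< j → j ℕ.< l → 2^ i ℚ.+ 2^ j ℚ.< 2^ k ℚ.+ 2^ l
  sum-< {i} {j} {k} {l} i<j j<l = begin-strict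
    2^ i ℚ.+ 2^ j  <⟨ ℚ.+-monoˡ-< (2^ j) (2^-mono i<j) ⟩
    2^ j ℚ.+ 2^ j  ≤⟨ 2^-double (ℕ.<⇒<′ j<l) ⟩
    2^ l           ≡⟨ sym (ℚ.+-identityˡ (2^ l)) ⟩
    0ℚ ℚ.+ 2^ l    <⟨ ℚ.+-monoˡ-< (2^ l) (2^-pos k) ⟩
    2^ k ℚ.+ 2^ l  ∎
    where open ℚ.≤-Reasoning

  sum-injective : ∀ {i j k l} → i ℕ.< j → k ℕ.< l →
    2^ i ℚ.+ 2^ j ≡ 2^ k ℚ.+ 2^ l → i ≡ k × j ≡ l
  sum-injective {i} {j} {k} {l} i<j k<l e with ℕ.<-cmp j l
  ... | tri< lt _ _   = contradiction (sum-< {k = k} i<j lt) (ℚ.<-irrefl e)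
  ... | tri≈ _ refl _ = 2^-injective (∙-cancelʳ ℚ.+-0-group (2^ j) (2^ i) (2^ k) e) , refl
  ... | tri> _ _ gt   = contradiction (sum-< {k = i} k<l gt) (ℚ.<-irrefl (sym e))

  lookup-injective : ∀ {A : Set} {xs : List A} → Unique xs → ∀ i j →
    List.lookup xs i ≡ List.lookup xs j → i ≡ j
  lookup-injective (_ ∷ _) Fin.zero Fin.zero _ = refl
  lookup-injective {xs = _ List.∷ xs} (x∉ ∷ _) Fin.zero (Fin.suc j) e =
    contradiction e (All.lookup x∉ (∈-lookup j))
  lookup-injective {xs = _ List.∷ xs} (x∉ ∷ _) (Fin.suc i) Fin.zero e =
    contradiction (sym e) (All.lookup x∉ (∈-lookup i))
  lookup-injective (_ ∷ u) (Fin.suc i) (Fin.suc j) e = cong Fin.suc (lookup-injective u i j e)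

  square-diff : ∀ s t → t ℚ.* t ℚ.- s ℚ.* s ≡ (s ℚ.+ t) ℚ.* (t ℚ.- s)
  square-diff = solve 2 (λ s t → t :* t :- s :* s := (s :+ t) :* (t :- s)) refl
    where open +-*-Solver

  square-slope : ∀ a b c → (b ℚ.- a) ℚ.* (c ℚ.- (a ℚ.+ b)) ≡ c ℚ.* (b ℚ.- a) ℚ.- (b ℚ.* b ℚ.- a ℚ.* a)
  square-slope = solve 3 (λ a b c →
      (b :- a) :* (c :- (a :+ b)) := c :* (b :- a) :- (b :* b :- a :* a)) refl
    where open +-*-Solver

  chord : ∀ a b c → a ≢ b → c ≡ a ℚ.+ b →
    HasSlope (onParabola a) (onParabola b) (finite (fromℚ c))
  chord a b _ a≢b refl = (λ e → a≢b (fromℚ-injective e)) , ≡⇒≈ (λ _ → square-diff a b)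

  chord-unique : ∀ a b c → HasSlope (onParabola a) (onParabola b) (finite (fromℚ c)) → c ≡ a ℚ.+ b
  chord-unique a b c (a≉b , e) = p-q≡0⇒p≡q c (a ℚ.+ b)
    (*-zero-cancel (b ℚ.- a) (c ℚ.- (a ℚ.+ b)) b-a≢0 (trans (square-slope a b c)
      (trans (cong (λ z → c ℚ.* (b ℚ.- a) ℚ.- z) e′) (ℚ.+-inverseʳ (c ℚ.* (b ℚ.- a))))))
    where
    e′ : b ℚ.* b ℚ.- a ℚ.* a ≡ c ℚ.* (b ℚ.- a)
    e′ = fromℚ-injective (mk≈ (close e))
    b-a≢0 : b ℚ.- a ≢ 0ℚ
    b-a≢0 h = a≉b (≡⇒≈ λ _ → sym (p-q≡0⇒p≡q b a h))

private
  module Parabola (n : ℕ) where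

    2^ᶠ : Fin n → ℚ
    2^ᶠ i = 2^ (toℕ i)

    σ : Fin n × Fin n → ℚ
    σ (i , j) = 2^ᶠ i ℚ.+ 2^ᶠ j

    2^ᶠ-injective : ∀ {i j} → 2^ᶠ i ≡ 2^ᶠ j → i ≡ j
    2^ᶠ-injective e = Fin.toℕ-injective (2^-injective e)

    points : PointSet n
    points = record
      { point    = λ i → onParabola (2^ᶠ i)
      ; distinct = λ (e , _) → 2^ᶠ-injective (fromℚ-injective e)
      }

  module Edges {n} (G : Graph n) (_~?_ : Decidable (Adjacent G)) where
    open Graph G
    open Parabola n

    IsEdge : Fin n × Fin n → Set
    IsEdge (i , j) = i Fin.< j × i ~ j

    isEdge? : ∀ e → Dec (IsEdge e)
    isEdge? (i , j) = (i Fin.<? j) ×-dec (i ~? j)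

    pairs edges : List (Fin n × Fin n)
    pairs = cartesianProduct (allFin n) (allFin n)
    edges = filter isEdge? pairs

    edges-unique : Unique edges
    edges-unique = Unique.filter⁺ isEdge?
      (Unique.cartesianProduct⁺ (Unique.allFin⁺ n) (Unique.allFin⁺ n))

    edge : Fin (length edges) → Fin n × Fin n
    edge = List.lookup edges

    edge-isEdge : ∀ t → IsEdge (edge t)
    edge-isEdge t = proj₂ (∈-filter⁻ isEdge? {xs = pairs} (∈-lookup t))

    find : ∀ {i j} → i Fin.< j → i ~ j → ∃[ t ] edge t ≡ (i , j)
    find {i} {j} i<j i~j = index mem , sym (lookup-index mem)
      where
      mem : (i , j) List.∈ edges
      mem = ∈-filter⁺ isEdge? (∈-cartesianProduct⁺ (∈-allFin i) (∈-allFin j)) (i<j , i~j)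

    σ-injective : ∀ {d e} → proj₁ d Fin.< proj₂ d → proj₁ e Fin.< proj₂ e → σ d ≡ σ e → d ≡ e
    σ-injective d< e< h with sum-injective d< e< h
    ... | p , q = cong₂ _,_ (Fin.toℕ-injective p) (Fin.toℕ-injective q)

    slopes : SlopeSet (length edges)
    slopes = record
      { slope    = λ t → finite (fromℚ (σ (edge t)))
      ; distinct = λ { {s} {t} (finite e) → lookup-injective edges-unique s t
          (σ-injective (proj₁ (edge-isEdge s)) (proj₁ (edge-isEdge t)) (fromℚ-injective e)) }
      }

    H : Graph n
    H = slopeGraph points slopes

    ⇒ : ∀ {v w} → v Fin.< w → v ~ w → Adjacent H v w
    ⇒ {v} {w} v<w v~w = let t , e = find v<w v~w in
      v≢w , t , chord (2^ᶠ v) (2^ᶠ w) (σ (edge t)) (v≢w ∘ 2^ᶠ-injective) (cong σ e)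
      where
      v≢w : v ≢ w
      v≢w = Fin.<⇒≢ v<w

    ⇐ : ∀ {v w} → v Fin.< w → Adjacent H v w → v ~ w
    ⇐ {v} {w} v<w (_ , t , h) = subst (λ e → proj₁ e ~ proj₂ e) edge≡ (proj₂ (edge-isEdge t))
      where
      edge≡ : edge t ≡ (v , w)
      edge≡ = σ-injective {edge t} {v , w} (proj₁ (edge-isEdge t)) v<w
        (chord-unique (2^ᶠ v) (2^ᶠ w) (σ (edge t)) h)

    to : ∀ v w → v ~ w → Adjacent H v w
    to v w v~w with Fin.<-cmp v w
    ... | tri< v<w _ _ = ⇒ v<w v~w
    ... | tri≈ _ v≡w _ = contradiction v~w (~-irrefl v≡w)
    ... | tri> _ _ w<v = Graph.~-sym H (⇒ w<v (~-sym v~w))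

    from : ∀ v w → Adjacent H v w → v ~ w
    from v w a with Fin.<-cmp v w
    ... | tri< v<w _ _ = ⇐ v<w a
    ... | tri≈ _ v≡w _ = contradiction v≡w (proj₁ a)
    ... | tri> _ _ w<v = ~-sym (⇐ w<v (Graph.~-sym H a))

representable : (G : Graph n) → Decidable (Adjacent G) → ∃[ k ] Representable G k
representable {n} G _~?_ = length edges , n , Parabola.points n , slopes ,
  ↔-id _ , λ v w → mk⇔ (to v w) (from v w)
  where open Edges G _~?_

slopeParameter-exists : (G : Graph n) → Decidable (Adjacent G) → ¬ ¬ (∃[ k ] IsSlopeParameter G k)
slopeParameter-exists G _~?_ = let k , rep = representable G _~?_ in least k rep

regular⇒decidable : ∀ {Δ} (G : Graph n) → Regular Δ G → Decidable (Adjacent G)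
regular⇒decidable G reg v w = let N , _ , N⇔ = reg v in map (N⇔ w) (w ∈? N)

slopeParameter-unique : (G : Graph n) → ∀ {k l} →
  IsSlopeParameter G k → IsSlopeParameter G l → k ≡ l
slopeParameter-unique G {k} {l} (rk , mk) (rl , ml) = ℕ.≤-antisym (mk l rl) (ml k rk)

{-# OPTIONS --safe #-}
-- Fix a number k of slopes.  Whether two points span one of them is decided by which of about kn²
-- quadratic polynomials in the 2n coordinates and the k slopes vanish, so it suffices to bound the
-- number of zero patterns of such a system (Rónyai, Babai, Ganapathy).  For a realizable support W
-- let g_W be the product of the polynomials in W.  At a realization of W, only those g_V with V ⊆ W
-- do not vanish, so the g_W are linearly independent; they have degree O(n²) in each unknown, hence
-- there are at most O(n²)^(2n + k) of them.  The choice of the slopes that are ∞ costs only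
-- a factor 2^k.
--
-- On the other hand, choosing Δ² permutations of m points to lift K_{Δ,Δ}, and adding a bounded
-- number of copies of K_{Δ+1} to adjust the number of vertices, gives (m!)^(Δ²) = n^(Δn/2) / O(1)^n
-- labelled Δ-regular graphs.  If 2 (2n + k) ≤ (1 − 1/q) Δn / 2, these outnumber the zero patterns.
--
-- The argument is made constructive by reading it over ℚ: given too many supports, a linear relation
-- between the g_W is computed, and a minimal support occurring in it is one that no sequence of
-- rational points realizes in the limit.  This yields a finite list of candidate patterns, and a
-- graph fitting none of them is found by search.  That the coordinates are reals enters only through
-- the double negation of "each polynomial value is zero or apart from zero", which suffices to
-- refute representability.
module Submission where

-- Rational sequences that tend to zero, are bounded, or stay away from zero

module Sequences where

  open import Data.Fin.Base using (Fin; zero; suc)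
  open import Data.Nat.Base as ℕ using (ℕ)
  import Data.Nat.Properties as ℕ
  open import Data.Product.Base using (∃-syntax; _×_; _,_)
  open import Data.Rational.Base
  open import Data.Rational.Properties
  open import Data.Rational.Solver using (module +-*-Solver)
  open import Function.Base using (_∘_)
  open import Relation.Binary.PropositionalEquality
    using (_≡_; _≢_; refl; sym; trans; cong; subst)
  open import Relation.Nullary.Negation using (¬_)

  open import Algebra.Bundles using (CommutativeRing)
  open import Algebra.Properties.Semiring.Sum (CommutativeRing.semiring +-*-commutativeRing) using (sum)

  Sequence : Set
  Sequence = ℕ → ℚ

  -- `Null` has the shape of the field `close` of `_≈_`, so that for a difference of reals the two
  -- convert by `mk≈` and `close` alone. `Apart` is the positive form of a nonzero limit: the bound
  -- `g` is part of the data.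
  Null Bounded Apart : Sequence → Set
  Null a    = ∀ {δ} → 0ℚ < δ → ∃[ N ] (∀ {i} → N ℕ.≤ i → ∣ a i ∣ < δ)
  Bounded a = ∃[ B ] (0ℚ < B × ∃[ N ] (∀ {i} → N ℕ.≤ i → ∣ a i ∣ ≤ B))
  Apart a   = ∃[ g ] (0ℚ < g × ∃[ N ] (∀ {i} → N ℕ.≤ i → g ≤ ∣ a i ∣))

  *-pos : ∀ {p q} → 0ℚ < p → 0ℚ < q → 0ℚ < p * q
  *-pos {p} {q} p>0 q>0 = positive⁻¹ (p * q) {{pos*pos⇒pos p {{positive p>0}} q {{positive q>0}}}}

  half-pos : ∀ {δ} → 0ℚ < δ → 0ℚ < δ * ½
  half-pos δ>0 = *-pos δ>0 (positive⁻¹ ½)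

  half+half : ∀ δ → δ * ½ + δ * ½ ≡ δ
  half+half δ = trans (sym (*-distribˡ-+ δ ½ ½)) (*-identityʳ δ)

  null-cong : ∀ {a b} → (∀ i → a i ≡ b i) → Null a → Null b
  null-cong a≗b na δ>0 = let N , h = na δ>0 in N , λ {i} N≤i → subst (λ z → ∣ z ∣ < _) (a≗b i) (h N≤i)

  apart-cong : ∀ {a b} → (∀ i → a i ≡ b i) → Apart a → Apart b
  apart-cong a≗b (g , g>0 , N , h) = g , g>0 , N , λ {i} N≤i → subst (λ z → g ≤ ∣ z ∣) (a≗b i) (h N≤i)

  null-zero : Null (λ _ → 0ℚ)
  null-zero δ>0 = 0 , λ _ → δ>0

  null-+ : ∀ {a b} → Null a → Null b → Null (λ i → a i + b i)
  null-+ {a} {b} na nb {δ} δ>0 with na (half-pos δ>0) | nb (half-pos δ>0)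
  ... | M , p | N , q = M ℕ.⊔ N , λ {i} h → begin-strict
    ∣ a i + b i ∣       ≤⟨ ∣p+q∣≤∣p∣+∣q∣ (a i) (b i) ⟩
    ∣ a i ∣ + ∣ b i ∣   <⟨ +-mono-< (p (ℕ.m⊔n≤o⇒m≤o M N h)) (q (ℕ.m⊔n≤o⇒n≤o M N h)) ⟩
    δ * ½ + δ * ½       ≡⟨ half+half δ ⟩
    δ                   ∎
    where open ≤-Reasoning

  null-neg : ∀ {a} → Null a → Null (λ i → - a i)
  null-neg {a} na {δ} δ>0 = let N , h = na δ>0 in
    N , λ {i} N≤i → subst (_< δ) (sym (∣-p∣≡∣p∣ (a i))) (h N≤i)

  null-sum : ∀ {n} (a : Fin n → Sequence) → (∀ l → Null (a l)) → Null (λ i → sum (λ l → a l i))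
  null-sum {ℕ.zero}  a h = null-zero
  null-sum {ℕ.suc n} a h = null-+ (h zero) (null-sum (a ∘ suc) (h ∘ suc))

  -- Isolates the surviving term of a linear relation. The other terms are subtracted from the null
  -- sum: one at a time until `l` is reached, then all the rest at once.
  null-single : ∀ {n} (a : Fin n → Sequence) l → (∀ l′ → l′ ≢ l → Null (a l′)) →
    Null (λ i → sum (λ l → a l i)) → Null (a l)
  null-single a zero h hs = null-cong (λ i → cancel (a zero i) _)
    (null-+ hs (null-neg (null-sum (a ∘ suc) λ l → h (suc l) λ ())))
    where
    open +-*-Solver
    cancel : ∀ p q → p + q - q ≡ p
    cancel = solve 2 (λ p q → p :+ q :- q := p) refl
  null-single a (suc l) h hs = null-single (a ∘ suc) l (λ l′ ne → h (suc l′) λ { refl → ne refl })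
    (null-cong (λ i → cancel (a zero i) _) (null-+ (null-neg (h zero λ ())) hs))
    where
    open +-*-Solver
    cancel : ∀ p q → - p + (p + q) ≡ q
    cancel = solve 2 (λ p q → :- p :+ (p :+ q) := q) refl

  bounded-const : ∀ p → Bounded (λ _ → p)
  bounded-const p = ∣ p ∣ + 1ℚ , +-mono-≤-< (0≤∣p∣ p) (positive⁻¹ 1ℚ) , 0 ,
    λ _ → subst (_≤ ∣ p ∣ + 1ℚ) (+-identityʳ ∣ p ∣) (+-monoʳ-≤ ∣ p ∣ (<⇒≤ (positive⁻¹ 1ℚ)))

  *-mono-≤ : ∀ {p q r s} → 0ℚ ≤ p → 0ℚ ≤ s → p ≤ q → r ≤ s → p * r ≤ q * s
  *-mono-≤ {p} {q} {r} {s} 0≤p 0≤s p≤q r≤s = ≤-trans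
    (*-monoˡ-≤-nonNeg p {{nonNegative 0≤p}} r≤s) (*-monoʳ-≤-nonNeg s {{nonNegative 0≤s}} p≤q)

  bounded-* : ∀ {a b} → Bounded a → Bounded b → Bounded (λ i → a i * b i)
  bounded-* {a} {b} (A , A>0 , M , p) (B , B>0 , N , q) = A * B , *-pos A>0 B>0 , M ℕ.⊔ N , λ {i} h →
    subst (_≤ A * B) (sym (∣p*q∣≡∣p∣*∣q∣ (a i) (b i)))
      (*-mono-≤ (0≤∣p∣ (a i)) (<⇒≤ B>0) (p (ℕ.m⊔n≤o⇒m≤o M N h)) (q (ℕ.m⊔n≤o⇒n≤o M N h)))

  apart-const : ∀ {p} → p ≢ 0ℚ → Apart (λ _ → p)
  apart-const {p} p≢0 = ∣ p ∣ , positive⁻¹ ∣ p ∣ {{∣p∣-pos}} , 0 , λ _ → ≤-refl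
    where
    ∣p∣-pos : Positive ∣ p ∣
    ∣p∣-pos = nonNeg∧nonZero⇒pos ∣ p ∣ {{∣-∣-nonNeg p}} {{≢-nonZero (p≢0 ∘ ∣p∣≡0⇒p≡0 p)}}

  apart-* : ∀ {a b} → Apart a → Apart b → Apart (λ i → a i * b i)
  apart-* {a} {b} (g , g>0 , M , p) (h , h>0 , N , q) = g * h , *-pos g>0 h>0 , M ℕ.⊔ N , λ {i} k →
    subst (g * h ≤_) (sym (∣p*q∣≡∣p∣*∣q∣ (a i) (b i)))
      (*-mono-≤ (<⇒≤ g>0) (0≤∣p∣ (b i)) (p (ℕ.m⊔n≤o⇒m≤o M N k)) (q (ℕ.m⊔n≤o⇒n≤o M N k)))

  null-*-bounded : ∀ {a b} → Null a → Bounded b → Null (λ i → a i * b i)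
  null-*-bounded {a} {b} na (B , B>0 , N , q) {δ} δ>0 =
    let δ′ = δ * 1/ B
        M , p = na (*-pos δ>0 (positive⁻¹ (1/ B) {{1/pos⇒pos B}}))
    in M ℕ.⊔ N , λ {i} h → begin-strict
    ∣ a i * b i ∣       ≡⟨ ∣p*q∣≡∣p∣*∣q∣ (a i) (b i) ⟩
    ∣ a i ∣ * ∣ b i ∣   ≤⟨ *-monoˡ-≤-nonNeg ∣ a i ∣ {{∣-∣-nonNeg (a i)}} (q (ℕ.m⊔n≤o⇒n≤o M N h)) ⟩
    ∣ a i ∣ * B         <⟨ *-monoˡ-<-pos B (p (ℕ.m⊔n≤o⇒m≤o M N h)) ⟩
    δ * 1/ B * B        ≡⟨ *-assoc δ (1/ B) B ⟩
    δ * (1/ B * B)      ≡⟨ cong (δ *_) (*-inverseˡ B) ⟩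
    δ * 1ℚ              ≡⟨ *-identityʳ δ ⟩
    δ                   ∎
    where
    open ≤-Reasoning
    instance
      B-pos : Positive B
      B-pos = positive B>0
      B-nonZero : NonZero B
      B-nonZero = pos⇒nonZero B

  null⇒¬apart : ∀ {a} → Null a → ¬ Apart a
  null⇒¬apart na (g , g>0 , N , h) = let M , p = na g>0 in
    <-irrefl refl (≤-<-trans (h (ℕ.m≤n⊔m M N)) (p (ℕ.m≤m⊔n M N)))

-- Linear dependence over the rationals

module Linear where

  open import Algebra.Bundles using (CommutativeRing)
  open import Data.Fin.Base using (Fin; zero; suc; punchIn)
  open import Data.Fin.Properties using (any?)
  open import Data.Nat.Base using (zero; suc)
  open import Data.Product.Base using (Σ-syntax; ∃-syntax; _×_; _,_)
  open import Data.Rational.Base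
  open import Data.Rational.Properties
  open import Data.Rational.Solver using (module +-*-Solver)
  open import Algebra.Properties.Semiring.Sum (CommutativeRing.semiring +-*-commutativeRing)
    using (sum; sum-remove; sum-cong-≗; ∑-distrib-+; *-distribʳ-sum; sum-replicate-zero)
  open import Data.Vec.Functional using (insertAt; _∷_)
  open import Data.Vec.Functional.Properties using (insertAt-lookup; insertAt-punchIn)
  open import Relation.Binary.PropositionalEquality
  open import Relation.Nullary.Decidable using (yes; no; ¬?; decidable-stable)

  *-cancelˡ-zero : ∀ p q → p ≢ 0ℚ → p * q ≡ 0ℚ → q ≡ 0ℚ
  *-cancelˡ-zero p q p≢0 e = begin
    q                ≡⟨ *-identityˡ q ⟨
    1ℚ * q           ≡⟨ cong (_* q) (*-inverseˡ p) ⟨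
    1/ p * p * q     ≡⟨ *-assoc (1/ p) p q ⟩
    1/ p * (p * q)   ≡⟨ cong (1/ p *_) e ⟩
    1/ p * 0ℚ        ≡⟨ *-zeroʳ (1/ p) ⟩
    0ℚ               ∎
    where
    open ≡-Reasoning
    instance
      p-nonZero : NonZero p
      p-nonZero = ≢-nonZero p≢0

  sum-zero : ∀ {n} (a : Fin n → ℚ) → (∀ l → a l ≡ 0ℚ) → sum a ≡ 0ℚ
  sum-zero {n} a h = trans (sum-cong-≗ h) (sum-replicate-zero n)

  Dependent : ∀ {n d} → (Fin n → Fin d → ℚ) → Set
  Dependent {n} v = Σ[ c ∈ (Fin n → ℚ) ] ((∃[ l ] c l ≢ 0ℚ) × (∀ e → sum (λ l → c l * v l e) ≡ 0ℚ))

  -- Elimination without division: cross-multiplication with the pivot row `p` clears column `zero`,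
  -- and that column and row are then dropped.
  reduce : ∀ {n d} → (Fin (suc n) → Fin (suc d) → ℚ) → Fin (suc n) → Fin n → Fin d → ℚ
  reduce v p l e = v p zero * v (punchIn p l) (suc e) - v (punchIn p l) zero * v p (suc e)

  -- A relation `c` between the reduced rows multiplies out to one between the original rows: each
  -- of the other rows gets `a * c l`, and the pivot row collects `- s`. In column `zero` every
  -- summand contains `a * b l - b l * a`.
  eliminate : ∀ {n d} (v : Fin (suc n) → Fin (suc d) → ℚ) p → v p zero ≢ 0ℚ →
    Dependent (reduce v p) → Dependent v
  eliminate {n} {d} v p a≢0 (c , (l , cl≢0) , dep) = c′ , (punchIn p l , nonzero) , vanish
    where
    a s : ℚ
    a = v p zero
    b : Fin n → ℚ
    b l = v (punchIn p l) zero
    s = sum (λ l → c l * b l)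
    c′ : Fin (suc n) → ℚ
    c′ = insertAt (λ l → a * c l) p (- s)
    c′-pivot : c′ p ≡ - s
    c′-pivot = insertAt-lookup (λ l → a * c l) p (- s)
    c′-punchIn : ∀ l → c′ (punchIn p l) ≡ a * c l
    c′-punchIn = insertAt-punchIn (λ l → a * c l) p (- s)
    nonzero : c′ (punchIn p l) ≢ 0ℚ
    nonzero e = cl≢0 (*-cancelˡ-zero a (c l) a≢0 (trans (sym (c′-punchIn l)) e))
    open ≡-Reasoning
    combine-pivot : ∀ e → sum (λ l → c′ l * v l e) ≡ sum (λ l → c l * (a * v (punchIn p l) e - b l * v p e))
    combine-pivot e = begin
      sum (λ l → c′ l * v l e)
        ≡⟨ sum-remove {i = p} (λ l → c′ l * v l e) ⟩
      c′ p * v p e + sum (λ l → c′ (punchIn p l) * v (punchIn p l) e)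
        ≡⟨ cong₂ _+_ (trans (cong (_* v p e) c′-pivot) (lemma₁ s (v p e)))
             (sum-cong-≗ λ l → cong (_* v (punchIn p l) e) (c′-punchIn l)) ⟩
      s * - v p e + sum (λ l → a * c l * v (punchIn p l) e)
        ≡⟨ cong (_+ sum (λ l → a * c l * v (punchIn p l) e)) (*-distribʳ-sum (- v p e) (λ l → c l * b l)) ⟩
      sum (λ l → c l * b l * - v p e) + sum (λ l → a * c l * v (punchIn p l) e)
        ≡⟨ ∑-distrib-+ (λ l → c l * b l * - v p e) (λ l → a * c l * v (punchIn p l) e) ⟨
      sum (λ l → c l * b l * - v p e + a * c l * v (punchIn p l) e)
        ≡⟨ sum-cong-≗ (λ l → lemma₂ (c l) (b l) (v p e) a (v (punchIn p l) e)) ⟩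
      sum (λ l → c l * (a * v (punchIn p l) e - b l * v p e)) ∎
      where
      open +-*-Solver
      lemma₁ : ∀ x y → - x * y ≡ x * - y
      lemma₁ = solve 2 (λ x y → :- x :* y := x :* :- y) refl
      lemma₂ : ∀ c b w a x → c * b * - w + a * c * x ≡ c * (a * x - b * w)
      lemma₂ = solve 5 (λ c b w a x → c :* b :* :- w :+ a :* c :* x := c :* (a :* x :- b :* w)) refl
    vanish : ∀ e → sum (λ l → c′ l * v l e) ≡ 0ℚ
    vanish (suc e) = trans (combine-pivot (suc e)) (dep e)
    vanish zero = trans (combine-pivot zero) (sum-zero _ λ l → lemma (c l) a (b l))
      where
      open +-*-Solver
      lemma : ∀ c a b → c * (a * b - b * a) ≡ 0ℚ
      lemma = solve 3 (λ c a b → c :* (a :* b :- b :* a) := con 0ℚ) refl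

  dependent : ∀ d (v : Fin (suc d) → Fin d → ℚ) → Dependent v
  dependent zero    v = (λ _ → 1ℚ) , (zero , λ ()) , λ ()
  dependent (suc d) v with any? (λ l → ¬? (v l zero ≟ 0ℚ))
  ... | yes (p , vp≢0) = eliminate v p vp≢0 (dependent d (reduce v p))
  -- Column `zero` vanishes and is dropped. One row has to go with it to keep the counts in step;
  -- the first row gets the coefficient `0ℚ`.
  ... | no  none with dependent d (λ l e → v (suc l) (suc e))
  ...   | c , (l , cl≢0) , dep = 0ℚ ∷ c , (suc l , cl≢0) , vanish
    where
    column-zero : ∀ l → v l zero ≡ 0ℚ
    column-zero l = decidable-stable (v l zero ≟ 0ℚ) λ ne → none (l , ne)
    vanish : ∀ e → sum (λ l → (0ℚ ∷ c) l * v l e) ≡ 0ℚ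
    vanish zero    = sum-zero _ λ l → trans (cong ((0ℚ ∷ c) l *_) (column-zero l)) (*-zeroʳ ((0ℚ ∷ c) l))
    vanish (suc e) = trans (cong₂ _+_ (*-zeroˡ (v zero (suc e))) (dep e)) (+-identityˡ 0ℚ)

-- Polynomials with degree bounds in each unknown

module Polynomials where

  open import Algebra.Bundles using (CommutativeRing)
  open import Data.Fin.Base using (Fin; zero; suc; toℕ; fromℕ<; funToFin; finToFun)
  import Data.Fin.Properties as Fin
  open import Data.List.Base using (List; []; _∷_; _++_; map; cartesianProductWith)
  open import Data.List.Relation.Unary.All as All using (All; []; _∷_)
  import Data.List.Relation.Unary.All.Properties as All
  open import Data.Nat.Base as ℕ using (ℕ; zero; suc)
  import Data.Nat.Properties as ℕ
  open import Data.Product.Base using (Σ-syntax; _×_; _,_; proj₁; proj₂)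
  open import Data.Rational.Base
  open import Data.Rational.Properties
  open import Data.Rational.Solver using (module +-*-Solver)
  open import Algebra.Properties.Semiring.Sum (CommutativeRing.semiring +-*-commutativeRing)
    using (sum; sum-cong-≗; ∑-distrib-+)
  open import Algebra.Properties.Semiring.Exp (CommutativeRing.semiring +-*-commutativeRing)
    using (_^_; ^-homo-*)
  import Algebra.Properties.CommutativeMonoid.Sum *-1-commutativeMonoid as Product
  import Algebra.Properties.CommutativeMonoid.Sum ℕ.+-0-commutativeMonoid as ℕ-Sum
  open import Function.Base using (_∘_)
  open import Relation.Binary.PropositionalEquality

  open Linear using (sum-zero)

  private
    variable
      m n : ℕ

  product : (Fin m → ℚ) → ℚ
  product = Product.sum

  Monomial Term Terms : ℕ → Set
  Monomial n = Fin n → ℕ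
  Term n     = ℚ × Monomial n
  Terms n    = List (Term n)

  evalMonomial : Monomial n → (Fin n → ℚ) → ℚ
  evalMonomial e u = product λ i → u i ^ e i

  evalTerms : Terms n → (Fin n → ℚ) → ℚ
  evalTerms []             u = 0ℚ
  evalTerms ((c , e) ∷ ts) u = c * evalMonomial e u + evalTerms ts u

  Bounded : Monomial n → Term n → Set
  Bounded d (_ , e) = ∀ i → e i ℕ.≤ d i

  -- d bounds the degree of F in each variable separately.
  record Polynomial (d : Monomial n) (F : (Fin n → ℚ) → ℚ) : Set where
    field
      terms   : Terms n
      bounded : All (Bounded d) terms
      eval    : ∀ u → F u ≡ evalTerms terms u

  open Polynomial

  _⊠_ : Term n → Term n → Term n
  (c , e) ⊠ (c′ , e′) = c * c′ , λ i → e i ℕ.+ e′ i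

  evalMonomial-+ : ∀ (e e′ : Monomial n) u →
    evalMonomial (λ i → e i ℕ.+ e′ i) u ≡ evalMonomial e u * evalMonomial e′ u
  evalMonomial-+ e e′ u = trans (Product.sum-cong-≗ λ i → ^-homo-* (u i) (e i) (e′ i))
    (Product.∑-distrib-+ (λ i → u i ^ e i) (λ i → u i ^ e′ i))

  evalTerms-++ : ∀ (ts us : Terms n) u → evalTerms (ts ++ us) u ≡ evalTerms ts u + evalTerms us u
  evalTerms-++ []             us u = sym (+-identityˡ (evalTerms us u))
  evalTerms-++ ((c , e) ∷ ts) us u = trans (cong (c * evalMonomial e u +_) (evalTerms-++ ts us u))
    (sym (+-assoc (c * evalMonomial e u) (evalTerms ts u) (evalTerms us u)))

  evalTerms-map : ∀ c (e : Monomial n) ts u →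
    evalTerms (map ((c , e) ⊠_) ts) u ≡ c * evalMonomial e u * evalTerms ts u
  evalTerms-map c e [] u = sym (*-zeroʳ (c * evalMonomial e u))
  evalTerms-map c e ((c′ , e′) ∷ ts) u = trans
    (cong₂ _+_ (cong (c * c′ *_) (evalMonomial-+ e e′ u)) (evalTerms-map c e ts u))
    (solve 5 (λ c c′ x y z → c :* c′ :* (x :* y) :+ c :* x :* z := c :* x :* (c′ :* y :+ z)) refl
      c c′ (evalMonomial e u) (evalMonomial e′ u) (evalTerms ts u))
    where open +-*-Solver

  evalTerms-* : ∀ (ts us : Terms n) u →
    evalTerms (cartesianProductWith _⊠_ ts us) u ≡ evalTerms ts u * evalTerms us u
  evalTerms-* [] us u = sym (*-zeroˡ (evalTerms us u))
  evalTerms-* ((c , e) ∷ ts) us u = begin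
    evalTerms (map ((c , e) ⊠_) us ++ cartesianProductWith _⊠_ ts us) u
      ≡⟨ evalTerms-++ (map ((c , e) ⊠_) us) (cartesianProductWith _⊠_ ts us) u ⟩
    evalTerms (map ((c , e) ⊠_) us) u + evalTerms (cartesianProductWith _⊠_ ts us) u
      ≡⟨ cong₂ _+_ (evalTerms-map c e us u) (evalTerms-* ts us u) ⟩
    c * evalMonomial e u * evalTerms us u + evalTerms ts u * evalTerms us u
      ≡⟨ *-distribʳ-+ (evalTerms us u) (c * evalMonomial e u) (evalTerms ts u) ⟨
    (c * evalMonomial e u + evalTerms ts u) * evalTerms us u ∎
    where open ≡-Reasoning

  bounded-* : ∀ {d d′ : Monomial n} {ts us} → All (Bounded d) ts → All (Bounded d′) us →
    All (Bounded λ i → d i ℕ.+ d′ i) (cartesianProductWith _⊠_ ts us)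
  bounded-* []       us = []
  bounded-* (t ∷ ts) us = All.++⁺ (All.map⁺ (All.map (λ b i → ℕ.+-mono-≤ (t i) (b i)) us)) (bounded-* ts us)

  weaken : ∀ {d d′ : Monomial n} {F} → (∀ i → d i ℕ.≤ d′ i) → Polynomial d F → Polynomial d′ F
  weaken d≤d′ P = record
    { terms   = terms P
    ; bounded = All.map (λ b i → ℕ.≤-trans (b i) (d≤d′ i)) (bounded P)
    ; eval    = eval P
    }

  evalMonomial-zero : ∀ (u : Fin n → ℚ) → evalMonomial (λ _ → 0) u ≡ 1ℚ
  evalMonomial-zero {n = n} u = Product.sum-replicate-zero n

  constant : ∀ c → Polynomial {n} (λ _ → 0) (λ _ → c)
  constant c = record
    { terms   = (c , λ _ → 0) ∷ []
    ; bounded = (λ i → ℕ.z≤n) ∷ []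
    ; eval    = λ u → sym (trans (+-identityʳ _)
        (trans (cong (c *_) (evalMonomial-zero u)) (*-identityʳ c)))
    }

  -- The Kronecker delta, as the exponent vector of a single unknown.
  δ : Fin n → Monomial n
  δ zero    zero    = 1
  δ zero    (suc j) = 0
  δ (suc i) zero    = 0
  δ (suc i) (suc j) = δ i j

  evalMonomial-δ : ∀ i (u : Fin n → ℚ) → evalMonomial (δ i) u ≡ u i
  evalMonomial-δ zero    u = trans (cong (u zero * 1ℚ *_) (evalMonomial-zero (u ∘ suc)))
    (trans (*-identityʳ (u zero * 1ℚ)) (*-identityʳ (u zero)))
  evalMonomial-δ (suc i) u = trans (*-identityˡ _) (evalMonomial-δ i (u ∘ suc))

  unknown : ∀ i → Polynomial {n} (δ i) (λ u → u i)
  unknown i = record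
    { terms   = (1ℚ , δ i) ∷ []
    ; bounded = (λ _ → ℕ.≤-refl) ∷ []
    ; eval    = λ u → sym (trans (+-identityʳ _) (trans (*-identityˡ _) (evalMonomial-δ i u)))
    }

  -- The bounds are added although their maximum would do. They thereby stay plain sums, which can
  -- be totalled over all forms later.
  _+ₚ_ : ∀ {d d′ : Monomial n} {F G} → Polynomial d F → Polynomial d′ G →
    Polynomial (λ i → d i ℕ.+ d′ i) (λ u → F u + G u)
  _+ₚ_ {d = d} {d′} P Q = record
    { terms   = terms P ++ terms Q
    ; bounded = All.++⁺ (All.map (λ b i → ℕ.≤-trans (b i) (ℕ.m≤m+n (d i) (d′ i))) (bounded P))
                        (All.map (λ b i → ℕ.≤-trans (b i) (ℕ.m≤n+m (d′ i) (d i))) (bounded Q))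
    ; eval    = λ u → trans (cong₂ _+_ (eval P u) (eval Q u)) (sym (evalTerms-++ (terms P) (terms Q) u))
    }

  _*ₚ_ : ∀ {d d′ : Monomial n} {F G} → Polynomial d F → Polynomial d′ G →
    Polynomial (λ i → d i ℕ.+ d′ i) (λ u → F u * G u)
  P *ₚ Q = record
    { terms   = cartesianProductWith _⊠_ (terms P) (terms Q)
    ; bounded = bounded-* (bounded P) (bounded Q)
    ; eval    = λ u → trans (cong₂ _*_ (eval P u) (eval Q u)) (sym (evalTerms-* (terms P) (terms Q) u))
    }

  -ₚ_ : ∀ {d : Monomial n} {F} → Polynomial d F → Polynomial d (λ u → - F u)
  -ₚ P = record
    { terms   = terms Q
    ; bounded = bounded Q
    ; eval    = λ u → trans (neg≡* _) (eval Q u)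
    }
    where
    Q = constant (- 1ℚ) *ₚ P
    neg≡* : ∀ p → - p ≡ - 1ℚ * p
    neg≡* p = trans (cong -_ (sym (*-identityˡ p))) (neg-distribˡ-* 1ℚ p)

  _-ₚ_ : ∀ {d d′ : Monomial n} {F G} → Polynomial d F → Polynomial d′ G →
    Polynomial (λ i → d i ℕ.+ d′ i) (λ u → F u - G u)
  P -ₚ Q = P +ₚ (-ₚ Q)

  productₚ : ∀ {d : Fin m → Monomial n} {F : Fin m → (Fin n → ℚ) → ℚ} →
    (∀ j → Polynomial (d j) (F j)) →
    Polynomial (λ i → ℕ-Sum.sum λ j → d j i) (λ u → product λ j → F j u)
  productₚ {m = zero}          P = constant 1ℚ
  productₚ {m = suc m} {d = d} {F} P = P zero *ₚ productₚ {d = d ∘ suc} {F ∘ suc} (P ∘ suc)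

  indicator : ∀ {k} → Fin k → ℚ → Fin k → ℚ
  indicator zero    c zero    = c
  indicator zero    c (suc j) = 0ℚ
  indicator (suc i) c zero    = 0ℚ
  indicator (suc i) c (suc j) = indicator i c j

  sum-indicator : ∀ {k} (i : Fin k) c (f : Fin k → ℚ) → sum (λ j → indicator i c j * f j) ≡ c * f i
  sum-indicator zero    c f = trans (cong (c * f zero +_) (sum-zero _ λ j → *-zeroˡ (f (suc j)))) (+-identityʳ _)
  sum-indicator (suc i) c f = trans (cong₂ _+_ (*-zeroˡ (f zero)) (sum-indicator i c (f ∘ suc))) (+-identityˡ _)

  -- The exponents are the digits of the index in base `E`, so every monomial with all exponents
  -- below `E` occurs.
  monomialOf : ∀ E → Fin (E ℕ.^ n) → Monomial n
  monomialOf E k i = toℕ (finToFun {E} k i)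

  -- Turns polynomials into vectors of dimension `E ^ n`, to which `dependent` applies. Each term
  -- adds its coefficient at the index of its monomial.
  coefficients : ∀ {E} {d : Monomial n} {F} → (∀ i → d i ℕ.< E) → Polynomial d F →
    Σ[ a ∈ (Fin (E ℕ.^ n) → ℚ) ] (∀ u → F u ≡ sum λ k → a k * evalMonomial (monomialOf E k) u)
  coefficients {n} {E} {d} d<E P = let a , h = go (terms P) (bounded P) in a , λ u → trans (eval P u) (h u)
    where
    go : ∀ ts → All (Bounded d) ts →
      Σ[ a ∈ (Fin (E ℕ.^ n) → ℚ) ] (∀ u → evalTerms ts u ≡ sum λ k → a k * evalMonomial (monomialOf E k) u)
    go [] [] = (λ _ → 0ℚ) , λ u → sym (sum-zero _ λ k → *-zeroˡ (evalMonomial (monomialOf E k) u))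
    go ((c , e) ∷ ts) (b ∷ bs) = (λ k → indicator k₀ c k + a k) , λ u → begin
      c * evalMonomial e u + evalTerms ts u
        ≡⟨ cong₂ _+_ (cong (c *_) (monomial≡ u)) (h u) ⟩
      c * μ u k₀ + sum (λ k → a k * μ u k)
        ≡⟨ cong (_+ sum (λ k → a k * μ u k)) (sum-indicator k₀ c (μ u)) ⟨
      sum (λ k → indicator k₀ c k * μ u k) + sum (λ k → a k * μ u k)
        ≡⟨ ∑-distrib-+ (λ k → indicator k₀ c k * μ u k) (λ k → a k * μ u k) ⟨
      sum (λ k → indicator k₀ c k * μ u k + a k * μ u k)
        ≡⟨ sum-cong-≗ (λ k → *-distribʳ-+ (μ u k) (indicator k₀ c k) (a k)) ⟨
      sum (λ k → (indicator k₀ c k + a k) * μ u k) ∎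
      where
      open ≡-Reasoning
      ih = go ts bs
      a = proj₁ ih
      h = proj₂ ih
      μ : (Fin n → ℚ) → Fin (E ℕ.^ n) → ℚ
      μ u k = evalMonomial (monomialOf E k) u
      e< : ∀ i → e i ℕ.< E
      e< i = ℕ.≤-<-trans (b i) (d<E i)
      k₀ = funToFin λ i → fromℕ< (e< i)
      monomial≡ : ∀ u → evalMonomial e u ≡ μ u k₀
      monomial≡ u = Product.sum-cong-≗ λ i → cong (u i ^_)
        (sym (trans (cong toℕ (Fin.finToFun-funToFin (λ i → fromℕ< (e< i)) i)) (Fin.toℕ-fromℕ< (e< i))))

-- Counting the zero patterns of a system of polynomials

module ZeroPatterns where

  open import Algebra.Bundles using (CommutativeRing)
  open import Data.Bool.Base using (Bool; true; false; if_then_else_)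
  open import Data.Fin.Base using (Fin; zero; suc)
  import Data.Fin.Properties as Fin
  open import Data.Fin.Subset using (Subset; inside; outside; _∈_; _∉_; _⊆_) renaming (∣_∣ to ∣_∣ₛ)
  import Data.Fin.Subset.Properties as Subset
  open import Data.List.Base as List using (List; []; _∷_; _++_; length; map; filter)
  open import Data.List.Membership.Propositional using () renaming (_∈_ to _∈ₗ_)
  open import Data.List.Membership.Propositional.Properties using (∈-map⁺; ∈-++⁺ˡ; ∈-++⁺ʳ; ∈-lookup; ∈-filter⁺)
  import Data.List.Properties as List
  import Data.List.Membership.DecPropositional as DecMembership
  open import Data.List.Relation.Unary.Any as Any using (here; there)
  import Data.List.Relation.Unary.All as All
  open import Data.List.Relation.Unary.All.Properties using (¬Any⇒All¬)
  open import Data.List.Relation.Unary.AllPairs using ([]; _∷_)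
  open import Data.List.Relation.Unary.Unique.Propositional using (Unique)
  import Data.List.Relation.Unary.Unique.Propositional.Properties as Unique
  open import Data.Sum.Base using (_⊎_; inj₁; inj₂)
  open import Data.Nat.Base as ℕ using (ℕ; zero; suc)
  import Data.Nat.Induction as ℕ
  import Data.Nat.Properties as ℕ
  open import Data.Product.Base using (Σ-syntax; ∃-syntax; _×_; _,_; proj₁; proj₂)
  open import Data.Rational.Base using (ℚ; 0ℚ; 1ℚ; _*_)
  open import Data.Rational.Properties
  import Data.Vec.Base as Vec
  import Data.Vec.Properties as Vec
  import Data.Bool.Properties as Bool
  open import Algebra.Properties.Semiring.Sum (CommutativeRing.semiring +-*-commutativeRing)
    using (sum; sum-cong-≗; ∑-comm; *-distribˡ-sum; *-distribʳ-sum)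
  import Algebra.Properties.CommutativeMonoid.Sum ℕ.+-0-commutativeMonoid as ℕ-Sum
  open import Function.Base using (_∘_)
  open import Function.Definitions using (Injective)
  open import Induction.WellFounded using (Acc; acc)
  open import Relation.Binary.Definitions using (DecidableEquality)
  open import Relation.Binary.PropositionalEquality
  open import Relation.Nullary.Decidable using (Dec; yes; no; ¬?; _×-dec_; decidable-stable)
  open import Relation.Nullary.Negation using (¬_; contradiction)

  open Sequences
  open Linear
  open Polynomials using (Monomial; Polynomial; weaken; constant; product; productₚ; coefficients; monomialOf; evalMonomial)

  private
    variable
      m n : ℕ

  argmin : (P : Fin n → Set) → (∀ l → Dec (P l)) → (f : Fin n → ℕ) → ∃[ l ] P l →
    ∃[ l ] (P l × (∀ l′ → P l′ → f l ℕ.≤ f l′))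
  argmin P P? f (l , pl) = go l pl (ℕ.<-wellFounded (f l))
    where
    go : ∀ l → P l → Acc ℕ._<_ (f l) → ∃[ l ] (P l × (∀ l′ → P l′ → f l ℕ.≤ f l′))
    go l pl (acc rs) with Fin.any? (λ l′ → P? l′ ×-dec (f l′ ℕ.<? f l))
    ... | yes (l′ , pl′ , lt) = go l′ pl′ (rs lt)
    ... | no  none            = l , pl , λ l′ pl′ → ℕ.≮⇒≥ λ lt → none (l′ , pl′ , lt)

  -- Lets a support of least cardinality serve as one that is minimal under inclusion.
  ⊆∧∣∣≤⇒≡ : ∀ (p q : Subset n) → p ⊆ q → ∣ q ∣ₛ ℕ.≤ ∣ p ∣ₛ → p ≡ q
  ⊆∧∣∣≤⇒≡ p q p⊆q le = Subset.⊆-antisym p⊆q q⊆p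
    where
    q⊆p : q ⊆ p
    q⊆p {x} x∈q with x Subset.∈? p
    ... | yes x∈p = x∈p
    ... | no  x∉p = contradiction (Subset.p⊂q⇒∣p∣<∣q∣ (p⊆q , x , x∈q , x∉p)) (ℕ.≤⇒≯ le)

  ⊈⇒∃ : ∀ (p q : Subset n) → ¬ p ⊆ q → ∃[ j ] (j ∈ p × j ∉ q)
  ⊈⇒∃ p q p⊈q with Fin.any? (λ j → (j Subset.∈? p) ×-dec ¬? (j Subset.∈? q))
  ... | yes found = found
  ... | no  none  = contradiction
    (λ {j} j∈p → decidable-stable (j Subset.∈? q) λ j∉q → none (j , j∈p , j∉q)) p⊈q

  bounded-product : (a : Fin m → Sequence) → (∀ j → Bounded (a j)) → Bounded (λ i → product λ j → a j i)
  bounded-product {zero}  a h = bounded-const 1ℚ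
  bounded-product {suc m} a h = bounded-* (h zero) (bounded-product (a ∘ suc) (h ∘ suc))

  apart-product : (a : Fin m → Sequence) → (∀ j → Apart (a j)) → Apart (λ i → product λ j → a j i)
  apart-product {zero}  a h = apart-const {1ℚ} λ ()
  apart-product {suc m} a h = apart-* (h zero) (apart-product (a ∘ suc) (h ∘ suc))

  null-product : (a : Fin m → Sequence) → (∀ j → Bounded (a j)) → ∀ j → Null (a j) →
    Null (λ i → product λ j → a j i)
  null-product a h zero    na = null-*-bounded na (bounded-product (a ∘ suc) (h ∘ suc))
  null-product a h (suc j) na = null-cong (λ i → *-comm _ (a zero i))
    (null-*-bounded (null-product (a ∘ suc) (h ∘ suc) j na) (h zero))

  lookup-injective : ∀ {A : Set} {xs : List A} → Unique xs → Injective _≡_ _≡_ (List.lookup xs)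
  lookup-injective (x∉ ∷ _) {zero}  {zero}  _ = refl
  lookup-injective {xs = _ ∷ xs} (x∉ ∷ _) {zero}  {suc j} e = contradiction e (All.lookup x∉ (∈-lookup j))
  lookup-injective {xs = _ ∷ xs} (x∉ ∷ _) {suc i} {zero}  e = contradiction (sym e) (All.lookup x∉ (∈-lookup i))
  lookup-injective (_ ∷ u) {suc i} {suc j} e = cong suc (lookup-injective u e)

  allSubsets : ∀ n → List (Subset n)
  allSubsets zero    = Vec.[] ∷ []
  allSubsets (suc n) = map (inside Vec.∷_) (allSubsets n) ++ map (outside Vec.∷_) (allSubsets n)

  ∈-allSubsets : ∀ (p : Subset n) → p ∈ₗ allSubsets n
  ∈-allSubsets Vec.[]             = here refl
  ∈-allSubsets (inside  Vec.∷ p) = ∈-++⁺ˡ (∈-map⁺ (inside Vec.∷_) (∈-allSubsets p))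
  ∈-allSubsets (outside Vec.∷ p) = ∈-++⁺ʳ _ (∈-map⁺ (outside Vec.∷_) (∈-allSubsets p))

  length-allSubsets : ∀ n → length (allSubsets n) ≡ 2 ℕ.^ n
  length-allSubsets zero    = refl
  length-allSubsets (suc n) = begin
    length (map (inside Vec.∷_) ps ++ map (outside Vec.∷_) ps)
      ≡⟨ List.length-++ (map (inside Vec.∷_) ps) ⟩
    length (map (inside Vec.∷_) ps) ℕ.+ length (map (outside Vec.∷_) ps)
      ≡⟨ cong₂ ℕ._+_ (List.length-map _ ps) (List.length-map _ ps) ⟩
    length ps ℕ.+ length ps
      ≡⟨ cong₂ ℕ._+_ (length-allSubsets n) (trans (length-allSubsets n) (sym (ℕ.+-identityʳ (2 ℕ.^ n)))) ⟩
    2 ℕ.^ suc n ∎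
    where
    open ≡-Reasoning
    ps = allSubsets n

  _≟ₛ_ : DecidableEquality (Subset n)
  _≟ₛ_ = Vec.≡-dec Bool._≟_

  module _ {E : ℕ} {d : Fin m → Monomial n} {F : Fin m → (Fin n → ℚ) → ℚ}
    (P : ∀ j → Polynomial (d j) (F j)) (d<E : ∀ i → ℕ-Sum.sum (λ j → d j i) ℕ.< E) where

    -- W is the support of F, that is the complement of its zero pattern, at the limit of the points ρ.
    record Realizable (W : Subset m) : Set where
      field
        ρ       : ℕ → Fin n → ℚ
        bounded : ∀ j → Bounded (λ i → F j (ρ i))
        apart   : ∀ j → j ∈ W → Apart (λ i → F j (ρ i))
        null    : ∀ j → j ∉ W → Null (λ i → F j (ρ i))

    private
      dim : ℕ
      dim = E ℕ.^ n

      factor : Bool → Fin m → (Fin n → ℚ) → ℚ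
      factor b j u = if b then F j u else 1ℚ

      -- The product g_W. Indices outside `W` contribute the factor `1ℚ`, so that one degree bound
      -- holds for all `W`.
      supportProduct : Subset m → (Fin n → ℚ) → ℚ
      supportProduct W u = product λ j → factor (Vec.lookup W j) j u

      factorₚ : ∀ b j → Polynomial (d j) (factor b j)
      factorₚ true  j = P j
      factorₚ false j = weaken (λ _ → ℕ.z≤n) (constant 1ℚ)

      supportProductₚ : ∀ W → Polynomial (λ i → ℕ-Sum.sum λ j → d j i) (supportProduct W)
      supportProductₚ W = productₚ {d = d} {λ j → factor (Vec.lookup W j) j} λ j → factorₚ (Vec.lookup W j) j

      bounded-factor : ∀ b j {ρ : ℕ → Fin n → ℚ} → Bounded (λ i → F j (ρ i)) → Bounded (λ i → factor b j (ρ i))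
      bounded-factor true  j h = h
      bounded-factor false j h = bounded-const 1ℚ

      apart-factor : ∀ {W} (R : Realizable W) j → Apart (λ i → factor (Vec.lookup W j) j (Realizable.ρ R i))
      apart-factor {W} R j with Vec.lookup W j in e
      ... | true  = Realizable.apart R j (Vec.lookup⇒[]= j W e)
      ... | false = apart-const {1ℚ} λ ()

      apart-supportProduct : ∀ {W} (R : Realizable W) → Apart (λ i → supportProduct W (Realizable.ρ R i))
      apart-supportProduct R = apart-product _ (apart-factor R)

      -- A member of `W′` outside `W` gives a null factor. The remaining factors have to be bounded,
      -- which is what the field `bounded` of `Realizable` provides.
      null-supportProduct : ∀ {W} (R : Realizable W) W′ → ¬ W′ ⊆ W →
        Null (λ i → supportProduct W′ (Realizable.ρ R i))
      null-supportProduct {W} R W′ W′⊈W with ⊈⇒∃ W′ W W′⊈W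
      ... | j , j∈W′ , j∉W = null-product _
        (λ j → bounded-factor (Vec.lookup W′ j) j (Realizable.bounded R j)) j
        (subst (λ b → Null (λ i → factor b j (Realizable.ρ R i))) (sym (Vec.[]=⇒lookup j∈W′))
          (Realizable.null R j j∉W))

    -- In a linear relation between the products of the supports, evaluation at a realization of a
    -- minimal support kills all the other terms.
    someUnrealizable : (W : Fin (suc dim) → Subset m) → Injective _≡_ _≡_ W → ∃[ l ] ¬ Realizable (W l)
    someUnrealizable W W-inj = l₀ , unrealizable
      where
      coeffs = λ l → coefficients {E = E} d<E (supportProductₚ (W l))
      a : Fin (suc dim) → Fin dim → ℚ
      a l = proj₁ (coeffs l)
      dep = dependent dim a
      c   = proj₁ dep
      μ : (Fin n → ℚ) → Fin dim → ℚ
      μ u k = evalMonomial (monomialOf E k) u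
      -- Expanding in monomials and exchanging the sums leaves, for each monomial, a column of the
      -- dependent coefficient vectors.
      relation : ∀ u → sum (λ l → c l * supportProduct (W l) u) ≡ 0ℚ
      relation u = begin
        sum (λ l → c l * supportProduct (W l) u)
          ≡⟨ sum-cong-≗ (λ l → trans (cong (c l *_) (proj₂ (coeffs l) u))
               (trans (*-distribˡ-sum (c l) (λ k → a l k * μ u k))
                 (sum-cong-≗ λ k → sym (*-assoc (c l) (a l k) (μ u k))))) ⟩
        sum (λ l → sum λ k → c l * a l k * μ u k)
          ≡⟨ ∑-comm (λ l k → c l * a l k * μ u k) ⟩
        sum (λ k → sum λ l → c l * a l k * μ u k)
          ≡⟨ sum-zero _ (λ k → trans (sym (*-distribʳ-sum (μ u k) (λ l → c l * a l k)))
               (trans (cong (_* μ u k) (proj₂ (proj₂ dep) k)) (*-zeroˡ (μ u k)))) ⟩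
        0ℚ ∎
        where open ≡-Reasoning
      minimal = argmin (λ l → c l ≢ 0ℚ) (λ l → ¬? (c l ≟ 0ℚ)) (λ l → ∣ W l ∣ₛ) (proj₁ (proj₂ dep))
      l₀ = proj₁ minimal
      unrealizable : ¬ Realizable (W l₀)
      unrealizable R = null⇒¬apart
        (null-single term l₀ others (null-cong (λ i → sym (relation (ρ i))) null-zero))
        (apart-* (apart-const (proj₁ (proj₂ minimal))) (apart-supportProduct R))
        where
        ρ = Realizable.ρ R
        term : Fin (suc dim) → Sequence
        term l i = c l * supportProduct (W l) (ρ i)
        others : ∀ l → l ≢ l₀ → Null (term l)
        others l l≢l₀ with c l ≟ 0ℚ
        ... | yes cl≡0 = null-cong
          (λ i → sym (trans (cong (_* supportProduct (W l) (ρ i)) cl≡0) (*-zeroˡ (supportProduct (W l) (ρ i))))) null-zero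
        ... | no  cl≢0 = null-cong (λ i → *-comm (supportProduct (W l) (ρ i)) (c l))
          (null-*-bounded
            (null-supportProduct R (W l) λ sub → l≢l₀
              (W-inj (⊆∧∣∣≤⇒≡ (W l) (W l₀) sub (proj₂ (proj₂ minimal) l cl≢0))))
            (bounded-const (c l)))

    private
      unrealizable-member : ∀ {Ws} → Unique Ws → length Ws ≡ suc dim → ∃[ l ] ¬ Realizable (List.lookup Ws l)
      unrealizable-member {Ws} u e = subst
        (λ k → (W : Fin k → Subset m) → Injective _≡_ _≡_ W → ∃[ l ] ¬ Realizable (W l))
        (sym e) someUnrealizable (List.lookup Ws) (lookup-injective u)

    -- The list may keep unrealizable sets: realizability is never decided, only the length is held
    -- down. Uniqueness is maintained because `someUnrealizable` takes distinct sets.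
    Cover : List (Subset m) → Set
    Cover Ws = Σ[ L ∈ List (Subset m) ]
      (length L ℕ.≤ dim × Unique L × (∀ {W} → W ∈ₗ Ws → Realizable W → W ∈ₗ L))

    private
      -- `W` is inserted. If this makes the list one longer than `dim`, then `someUnrealizable`
      -- points to a member whose deletion loses nothing realizable.
      cover-∷ : ∀ {Ws} W → Cover Ws → Cover (W ∷ Ws)
      cover-∷ {Ws} W (L , len , uniq , covers) with DecMembership._∈?_ _≟ₛ_ W L
      ... | yes W∈L = L , len , uniq , λ { (here refl) _ → W∈L ; (there W∈) → covers W∈ }
      ... | no  W∉L = extend (ℕ.m≤n⇒m<n∨m≡n len)
        where
        uniq′ : Unique (W ∷ L)
        uniq′ = ¬Any⇒All¬ L W∉L ∷ uniq
        covers′ : ∀ {V} → V ∈ₗ W ∷ Ws → Realizable V → V ∈ₗ W ∷ L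
        covers′ (here refl) _ = here refl
        covers′ (there V∈)  R = there (covers V∈ R)
        extend : length L ℕ.< dim ⊎ length L ≡ dim → Cover (W ∷ Ws)
        extend (inj₁ len<) = W ∷ L , len< , uniq′ , covers′
        extend (inj₂ len≡) = filter ≢U? (W ∷ L)
          , ℕ.s≤s⁻¹ (subst (length (filter ≢U? (W ∷ L)) ℕ.<_) (cong suc len≡)
              (List.filter-notAll ≢U? (W ∷ L) (Any.map (λ e ne → ne (sym e)) (∈-lookup {xs = W ∷ L} l))))
          , Unique.filter⁺ ≢U? uniq′
          , λ V∈ R → ∈-filter⁺ ≢U? (covers′ V∈ R) λ { refl → unrealizable R }
          where
          found = unrealizable-member uniq′ (cong suc len≡)
          l = proj₁ found
          unrealizable = proj₂ found
          U = List.lookup (W ∷ L) l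
          ≢U? = λ V → ¬? (V ≟ₛ U)

    cover : ∀ Ws → Cover Ws
    cover []       = [] , ℕ.z≤n , [] , λ ()
    cover (W ∷ Ws) = cover-∷ W (cover Ws)

    realizable-cover : Σ[ L ∈ List (Subset m) ] (length L ℕ.≤ E ℕ.^ n × (∀ {W} → Realizable W → W ∈ₗ L))
    realizable-cover = let L , len , _ , h = cover (allSubsets m) in L , len , h (∈-allSubsets _)

-- Encoding slope graphs by zero patterns

module SlopeCodes where

  open import Data.Bool.Base using (Bool; true; false)
  open import Data.Fin.Base using (Fin; zero; suc; _↑ˡ_; _↑ʳ_; splitAt; combine; remQuot)
  import Data.Fin.Properties as Fin
  open import Data.Fin.Subset using (Subset; _∈_)
  import Data.Fin.Subset.Properties as Subset
  open import Data.List.Base as List using (List; []; _∷_; length; cartesianProductWith)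
  open import Data.List.Membership.Propositional using () renaming (_∈_ to _∈ₗ_)
  open import Data.List.Membership.Propositional.Properties using (∈-cartesianProductWith⁺)
  import Data.List.Properties as List
  open import Data.Nat.Base as ℕ using (ℕ; zero; suc)
  import Data.Nat.Properties as ℕ
  import Data.Nat.Solver as ℕ-Solver
  open import Data.Product.Base using (Σ-syntax; ∃-syntax; _×_; _,_; proj₁; proj₂)
  open import Data.Rational.Base
  open import Data.Rational.Properties
  open import Data.Rational.Solver using (module +-*-Solver)
  open import Data.Sum.Base using (_⊎_; inj₁; inj₂; [_,_]′)
  import Data.Vec.Base as Vec
  import Data.Vec.Properties as Vec
  import Algebra.Properties.Semiring.Sum ℕ.+-*-semiring as ℕ-Sum
  open import Function.Base using (_∘_)
  open import Function.Bundles using (_⇔_; mk⇔; Equivalence; Injection; Inverse)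
  open import Function.Properties.Inverse using (↔⇒↣)
  open import Function.Definitions using (Injective)
  open import Relation.Binary.PropositionalEquality
  open import Relation.Nullary.Decidable using (Dec; yes; no; ¬?; _×-dec_)
  open import Relation.Nullary.Negation using (¬_; contradiction)

  open import Defs using (ℝ; 0ℝ; _≈_; mk≈; Graph; Adjacent; Representable; PointSet; SlopeSet; Point; Slope; finite; ∞; HasSlope; IsCauchy)
  import Defs as D
  open Sequences
  open Polynomials
    using (Monomial; Polynomial; weaken; unknown; δ; _-ₚ_; _*ₚ_)
  open ZeroPatterns

  open ℝ using (seq; cauchy)

  private
    variable
      m n k : ℕ

  -- A sequence that is not apart is null. Given ε, choose `N` beyond which the terms differ by less
  -- than ε/4. If `∣ a N ∣` is below ε/2, the tail is below ε; otherwise the tail stays at least ε/4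
  -- from zero, which is excluded. The case distinction is between rationals, hence decidable.
  cauchy⇒¬¬null⊎apart : ∀ {a} → IsCauchy a → ¬ ¬ (Null a ⊎ Apart a)
  cauchy⇒¬¬null⊎apart {a} ca none = none (inj₁ null)
    where
    null : Null a
    null {ε} ε>0 with ca (half-pos (half-pos ε>0))
    ... | N , h with ∣ a N ∣ <? ε * ½
    ...   | yes small = N , λ {i} N≤i → begin-strict
      ∣ a i ∣                   ≡⟨ cong ∣_∣ (solve 2 (λ s t → s := (s :- t) :+ t) refl (a i) (a N)) ⟩
      ∣ (a i - a N) + a N ∣     ≤⟨ ∣p+q∣≤∣p∣+∣q∣ (a i - a N) (a N) ⟩
      ∣ a i - a N ∣ + ∣ a N ∣   <⟨ +-mono-< (<-trans (h N≤i ℕ.≤-refl) quarter<half) small ⟩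
      ε * ½ + ε * ½             ≡⟨ half+half ε ⟩
      ε                         ∎
      where
      open ≤-Reasoning
      open +-*-Solver
      quarter<half : ε * ½ * ½ < ε * ½
      quarter<half = subst₂ _<_ (+-identityʳ _) (half+half (ε * ½))
        (+-monoʳ-< (ε * ½ * ½) (half-pos (half-pos ε>0)))
    ...   | no large = contradiction (inj₂ (ε * ½ * ½ , half-pos (half-pos ε>0) , N , λ {i} N≤i →
      +-cancelʳ-≤′ (ε * ½ * ½) (begin
      ε * ½ * ½ + ε * ½ * ½     ≡⟨ half+half (ε * ½) ⟩
      ε * ½                     ≤⟨ ≮⇒≥ large ⟩
      ∣ a N ∣                   ≡⟨ cong ∣_∣ (solve 2 (λ s t → t := s :+ (t :- s)) refl (a i) (a N)) ⟩
      ∣ a i + (a N - a i) ∣     ≤⟨ ∣p+q∣≤∣p∣+∣q∣ (a i) (a N - a i) ⟩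
      ∣ a i ∣ + ∣ a N - a i ∣   ≤⟨ +-monoʳ-≤ ∣ a i ∣ (<⇒≤ (h ℕ.≤-refl N≤i)) ⟩
      ∣ a i ∣ + ε * ½ * ½       ∎))) none
      where
      open ≤-Reasoning
      open +-*-Solver
      +-cancelʳ-≤′ : ∀ r {p q} → p + r ≤ q + r → p ≤ q
      +-cancelʳ-≤′ r {p} {q} le = subst₂ _≤_ (cancel p) (cancel q) (+-monoˡ-≤ (- r) le)
        where
        cancel : ∀ p → p + r - r ≡ p
        cancel p = solve 2 (λ p r → p :+ r :- r := p) refl p r

  cauchy⇒bounded : ∀ {a} → IsCauchy a → Bounded a
  cauchy⇒bounded {a} ca with ca (positive⁻¹ 1ℚ)
  ... | N , h = ∣ a N ∣ + 1ℚ , +-mono-≤-< (0≤∣p∣ (a N)) (positive⁻¹ 1ℚ) , N , λ {i} N≤i → begin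
    ∣ a i ∣                   ≡⟨ cong ∣_∣ (solve 2 (λ s t → s := t :+ (s :- t)) refl (a i) (a N)) ⟩
    ∣ a N + (a i - a N) ∣     ≤⟨ ∣p+q∣≤∣p∣+∣q∣ (a N) (a i - a N) ⟩
    ∣ a N ∣ + ∣ a i - a N ∣   ≤⟨ +-monoʳ-≤ ∣ a N ∣ (<⇒≤ (h N≤i ℕ.≤-refl)) ⟩
    ∣ a N ∣ + 1ℚ              ∎
    where
    open ≤-Reasoning
    open +-*-Solver

  -- The double-negation shift, by induction on the finite index set. It allows all forms to be
  -- decided at once.
  ¬¬-∀ : {A : Fin n → Set} → (∀ i → ¬ ¬ A i) → ¬ ¬ (∀ i → A i)
  ¬¬-∀ {zero}  h none = none λ ()
  ¬¬-∀ {suc n} h none = h zero λ a₀ → ¬¬-∀ (h ∘ suc) λ a → none λ { zero → a₀ ; (suc i) → a i }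

  length-cartesianProductWith : ∀ {A B C : Set} (f : A → B → C) xs ys →
    length (cartesianProductWith f xs ys) ≡ length xs ℕ.* length ys
  length-cartesianProductWith f []       ys = refl
  length-cartesianProductWith f (x ∷ xs) ys = trans (List.length-++ (List.map (f x) ys))
    (cong₂ ℕ._+_ (List.length-map (f x) ys) (length-cartesianProductWith f xs ys))

  open ℕ-Sum using (sum; sum-syntax; ∑-distrib-+; sum-cong-≗; *-distribˡ-sum)

  sum-const : ∀ n c → ∑[ i < n ] c ≡ n ℕ.* c
  sum-const zero    c = refl
  sum-const (suc n) c = cong (c ℕ.+_) (sum-const n c)

  sum-split : ∀ m (f : Fin (m ℕ.+ n) → ℕ) → sum f ≡ ∑[ i < m ] f (i ↑ˡ n) ℕ.+ ∑[ j < n ] f (m ↑ʳ j)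
  sum-split zero    f = refl
  sum-split (suc m) f = trans (cong (f zero ℕ.+_) (sum-split m (f ∘ suc))) (sym (ℕ.+-assoc (f zero) _ _))

  sum-combine : ∀ m (f : Fin (m ℕ.* n) → ℕ) → sum f ≡ ∑[ i < m ] ∑[ j < n ] f (combine i j)
  sum-combine         zero    f = refl
  sum-combine {n = n} (suc m) f = trans (sum-split n f) (cong (∑[ j < n ] f (j ↑ˡ (m ℕ.* n)) ℕ.+_) (sum-combine m (f ∘ (n ↑ʳ_))))

  δ-diagonal : ∀ (i : Fin n) → δ i i ≡ 1
  δ-diagonal zero    = refl
  δ-diagonal (suc i) = δ-diagonal i

  δ-off-diagonal : ∀ {i j : Fin n} → i ≢ j → δ i j ≡ 0
  δ-off-diagonal {i = zero}  {zero}  i≢j = contradiction refl i≢j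
  δ-off-diagonal {i = zero}  {suc j} i≢j = refl
  δ-off-diagonal {i = suc i} {zero}  i≢j = refl
  δ-off-diagonal {i = suc i} {suc j} i≢j = δ-off-diagonal (i≢j ∘ cong suc)

  sum-δ≤1 : (h : Fin m → Fin n) → Injective _≡_ _≡_ h → ∀ i → ∑[ j < m ] δ (h j) i ℕ.≤ 1
  sum-δ≤1 {zero}  h h-inj i = ℕ.z≤n
  sum-δ≤1 {suc m} h h-inj i with h zero Fin.≟ i
  ... | yes refl = ℕ.≤-reflexive (cong₂ ℕ._+_ (δ-diagonal (h zero))
    (trans (sum-cong-≗ {m} λ j → δ-off-diagonal (λ e → Fin.0≢1+n (sym (h-inj {suc j} {zero} e)))) (trans (sum-const m 0) (ℕ.*-zeroʳ m))))
  ... | no  h₀≢i = subst (ℕ._≤ 1) (sym (cong (ℕ._+ ∑[ j < m ] δ (h (suc j)) i) (δ-off-diagonal h₀≢i)))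
    (sum-δ≤1 (h ∘ suc) (Fin.suc-injective ∘ h-inj) i)

  -- The unknowns are the coordinates of n points and k finite slopes.  For two points and a slope,
  -- form _ _ zero vanishes when the points are equal or on a vertical line, and form _ _ (suc t)
  -- when they are equal or on a line of slope t.
  #vars #forms : ℕ → ℕ → ℕ
  #vars  n k = n ℕ.+ (n ℕ.+ k)
  #forms n k = n ℕ.* (n ℕ.* suc k)

  module _ {n k : ℕ} where

    xᵥ yᵥ : Fin n → Fin (#vars n k)
    xᵥ v = v ↑ˡ (n ℕ.+ k)
    yᵥ v = n ↑ʳ (v ↑ˡ k)

    sᵥ : Fin k → Fin (#vars n k)
    sᵥ t = n ↑ʳ (n ↑ʳ t)

    index : Fin n → Fin n → Fin (suc k) → Fin (#forms n k)
    index v w t = combine v (combine w t)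

    form : Fin n → Fin n → Fin (suc k) → (Fin (#vars n k) → ℚ) → ℚ
    form v w zero    u = u (xᵥ v) - u (xᵥ w)
    form v w (suc t) u = (u (yᵥ w) - u (yᵥ v)) - u (sᵥ t) * (u (xᵥ w) - u (xᵥ v))

    slotDegree : Fin (suc k) → Monomial (#vars n k)
    slotDegree zero    i = 0
    slotDegree (suc t) i = δ (sᵥ t) i

    pointDegree : Fin n → Monomial (#vars n k)
    pointDegree v i = δ (xᵥ v) i ℕ.+ δ (yᵥ v) i

    -- Both kinds of form get a bound of the same shape, a part for `v`, one for `w` and one for
    -- `t`, so that the sum over all forms separates. In the slot `zero` it is an overestimate.
    degree : Fin n → Fin n → Fin (suc k) → Monomial (#vars n k)
    degree v w t i = pointDegree v i ℕ.+ pointDegree w i ℕ.+ slotDegree t i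

    formₚ : ∀ v w t → Polynomial (degree v w t) (form v w t)
    formₚ v w zero    = weaken
      (λ i → ℕ.m≤n⇒m≤n+o 0 (ℕ.+-mono-≤ (ℕ.m≤m+n (δ (xᵥ v) i) _) (ℕ.m≤m+n (δ (xᵥ w) i) _)))
      (unknown (xᵥ v) -ₚ unknown (xᵥ w))
    formₚ v w (suc t) = weaken (λ i → ℕ.≤-reflexive (rearrange (δ (xᵥ v) i) (δ (yᵥ v) i) (δ (xᵥ w) i) (δ (yᵥ w) i) (δ (sᵥ t) i)))
      ((unknown (yᵥ w) -ₚ unknown (yᵥ v)) -ₚ (unknown (sᵥ t) *ₚ (unknown (xᵥ w) -ₚ unknown (xᵥ v))))
      where
      open ℕ-Solver.+-*-Solver
      rearrange : ∀ a b c d e → (d ℕ.+ b) ℕ.+ (e ℕ.+ (c ℕ.+ a)) ≡ (a ℕ.+ b) ℕ.+ (c ℕ.+ d) ℕ.+ e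
      rearrange = solve 5 (λ a b c d e → (d :+ b) :+ (e :+ (c :+ a)) := (a :+ b) :+ (c :+ d) :+ e) refl

    decode : Fin (#forms n k) → Fin n × Fin n × Fin (suc k)
    decode j = let v , j′ = remQuot (n ℕ.* suc k) j in v , remQuot (suc k) j′

    decode-index : ∀ v w t → decode (index v w t) ≡ (v , w , t)
    decode-index v w t = trans
      (cong (λ (v , j′) → v , remQuot (suc k) j′) (Fin.remQuot-combine v (combine w t)))
      (cong (v ,_) (Fin.remQuot-combine w t))

    -- Used for the forms, for their degrees and for their real values, which keeps the three
    -- aligned index by index.
    onDecoded : ∀ {a} {A : Set a} → (Fin n → Fin n → Fin (suc k) → A) → Fin (#forms n k) → A
    onDecoded f j = let v , w , t = decode j in f v w t

    onDecoded-index : ∀ {A : Set} (f : Fin n → Fin n → Fin (suc k) → A) v w t →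
      onDecoded f (index v w t) ≡ f v w t
    onDecoded-index f v w t = cong (λ (v , w , t) → f v w t) (decode-index v w t)

    forms : Fin (#forms n k) → (Fin (#vars n k) → ℚ) → ℚ
    forms = onDecoded form

    degrees : Fin (#forms n k) → Monomial (#vars n k)
    degrees = onDecoded degree

    formsₚ : ∀ j → Polynomial (degrees j) (forms j)
    formsₚ j = let v , w , t = decode j in formₚ v w t

    sum-decoded : (f : Fin n → Fin n → Fin (suc k) → ℕ) →
      sum (onDecoded f) ≡ ∑[ v < n ] ∑[ w < n ] ∑[ t < suc k ] f v w t
    sum-decoded f = trans (sum-combine n (onDecoded f)) (sum-cong-≗ λ v →
      trans (sum-combine n _) (sum-cong-≗ λ w → sum-cong-≗ λ t → onDecoded-index f v w t))

    sum-pointDegree≤2 : ∀ i → ∑[ v < n ] pointDegree v i ℕ.≤ 2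
    sum-pointDegree≤2 i = ℕ.≤-trans (ℕ.≤-reflexive (∑-distrib-+ (λ v → δ (xᵥ v) i) (λ v → δ (yᵥ v) i)))
      (ℕ.+-mono-≤ (sum-δ≤1 xᵥ (Fin.↑ˡ-injective (n ℕ.+ k) _ _) i)
                  (sum-δ≤1 yᵥ (Fin.↑ˡ-injective k _ _ ∘ Fin.↑ʳ-injective n _ _) i))

    sum-slotDegree≤1 : ∀ i → ∑[ t < suc k ] slotDegree t i ℕ.≤ 1
    sum-slotDegree≤1 i = sum-δ≤1 sᵥ (Fin.↑ʳ-injective n _ _ ∘ Fin.↑ʳ-injective n _ _) i

    -- Bounds the degree of every g_W in one unknown. The unknown belongs to few points and slopes:
    -- the point degrees sum to at most 2, once for `v` and once for `w`, and the slope degrees to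
    -- at most 1.
    sum-degrees≤ : ∀ i → sum (λ j → degrees j i) ℕ.≤ 4 ℕ.* (n ℕ.* suc k) ℕ.+ n ℕ.* n
    sum-degrees≤ i = begin
      sum (λ j → degrees j i)
        ≡⟨ sum-decoded (λ v w t → degree v w t i) ⟩
      ∑[ v < n ] ∑[ w < n ] ∑[ t < suc k ] (p v ℕ.+ p w ℕ.+ s t)
        ≡⟨ (sum-cong-≗ λ v → sum-cong-≗ λ w → trans (∑-distrib-+ (λ _ → p v ℕ.+ p w) s)
             (cong (ℕ._+ sum s) (sum-const (suc k) (p v ℕ.+ p w)))) ⟩
      ∑[ v < n ] ∑[ w < n ] (suc k ℕ.* (p v ℕ.+ p w) ℕ.+ sum s)
        ≡⟨ (sum-cong-≗ λ v → trans (∑-distrib-+ (λ w → suc k ℕ.* (p v ℕ.+ p w)) (λ _ → sum s))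
             (cong₂ ℕ._+_ (trans (sym (*-distribˡ-sum (suc k) (λ w → p v ℕ.+ p w)))
                (cong (suc k ℕ.*_) (trans (∑-distrib-+ (λ _ → p v) p) (cong (ℕ._+ sum p) (sum-const n (p v))))))
               (sum-const n (sum s)))) ⟩
      ∑[ v < n ] (suc k ℕ.* (n ℕ.* p v ℕ.+ sum p) ℕ.+ n ℕ.* sum s)
        ≡⟨ trans (∑-distrib-+ (λ v → suc k ℕ.* (n ℕ.* p v ℕ.+ sum p)) (λ _ → n ℕ.* sum s))
             (cong₂ ℕ._+_ (trans (sym (*-distribˡ-sum (suc k) (λ v → n ℕ.* p v ℕ.+ sum p))) (cong (suc k ℕ.*_)
                (trans (∑-distrib-+ (λ v → n ℕ.* p v) (λ _ → sum p)) (cong₂ ℕ._+_ (sym (*-distribˡ-sum n p)) (sum-const n (sum p))))))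
               (sum-const n (n ℕ.* sum s))) ⟩
      suc k ℕ.* (n ℕ.* sum p ℕ.+ n ℕ.* sum p) ℕ.+ n ℕ.* (n ℕ.* sum s)
        ≤⟨ ℕ.+-mono-≤ (ℕ.*-monoʳ-≤ (suc k) (ℕ.+-mono-≤ (ℕ.*-monoʳ-≤ n (sum-pointDegree≤2 i)) (ℕ.*-monoʳ-≤ n (sum-pointDegree≤2 i))))
             (ℕ.*-monoʳ-≤ n (ℕ.*-monoʳ-≤ n (sum-slotDegree≤1 i))) ⟩
      suc k ℕ.* (n ℕ.* 2 ℕ.+ n ℕ.* 2) ℕ.+ n ℕ.* (n ℕ.* 1)
        ≡⟨ solve 2 (λ T n → T :* (n :* con 2 :+ n :* con 2) :+ n :* (n :* con 1) := con 4 :* (n :* T) :+ n :* n) refl (suc k) n ⟩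
      4 ℕ.* (n ℕ.* suc k) ℕ.+ n ℕ.* n ∎
      where
      open ℕ.≤-Reasoning
      open ℕ-Solver.+-*-Solver
      p : Fin n → ℕ
      p v = pointDegree v i
      s : Fin (suc k) → ℕ
      s t = slotDegree t i

  -- `flags` marks the slopes that are `∞`, and `support` the forms that do not vanish.
  record Code (n k : ℕ) : Set where
    constructor mkCode
    field
      flags   : Subset k
      support : Subset (#forms n k)

  -- b tells whether the slope is ∞; X and L say that the abscissae differ and that the points do
  -- not satisfy the equation of the slope.
  Incident : Bool → Set → Set → Set
  Incident true  X L = ¬ X
  Incident false X L = X × ¬ L

  incident? : ∀ b {X L} → Dec X → Dec L → Dec (Incident b X L)
  incident? true  X? L? = ¬? X?
  incident? false X? L? = X? ×-dec ¬? L?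

  CodeAdjacent : Code n k → Fin n → Fin n → Set
  CodeAdjacent {n} {k} (mkCode flags W) v w = v ≢ w × ∃[ t ]
    Incident (Vec.lookup flags t) (index {n} {k} v w zero ∈ W) (index {n} {k} v w (suc t) ∈ W)

  codeAdjacent? : ∀ (c : Code n k) v w → Dec (CodeAdjacent c v w)
  codeAdjacent? {n} {k} (mkCode flags W) v w = ¬? (v Fin.≟ w) ×-dec Fin.any? λ t →
    incident? (Vec.lookup flags t) (index {n} {k} v w zero Subset.∈? W) (index {n} {k} v w (suc t) Subset.∈? W)

  Matches : Graph n → Code n k → Set
  Matches G c = ∀ v w → Adjacent G v w ⇔ CodeAdjacent c v w

  vertical : Slope → Bool
  vertical (finite r) = false
  vertical ∞          = true

  -- The default `0ℝ` at `∞` gives every slope an unknown; for such slopes `Incident` looks at the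
  -- abscissae only.
  value : Slope → ℝ
  value (finite r) = r
  value ∞          = 0ℝ

  -- `X` stands for the membership of a form in the support, and `z` for its value at the given
  -- points and slopes.
  Decides : Set → ℝ → Set
  Decides X z = (X → Apart (seq z)) × (¬ X → Null (seq z))

  -- A value cannot be both null and apart, which handles `≈` and its refutation. In the other
  -- direction, deciding `X` turns the negative statement `¬ x ≈ x′` into the positive `X`.
  hasSlope⇔incident : ∀ p q s {X L} → Dec X → Dec L →
    Decides X (proj₁ p D.- proj₁ q) →
    Decides L ((proj₂ q D.- proj₂ p) D.- value s D.* (proj₁ q D.- proj₁ p)) →
    HasSlope p q s ⇔ Incident (vertical s) X L
  hasSlope⇔incident (x , y) (x′ , y′) ∞ X? L? (X⇒ , ¬X⇒) _ = mk⇔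
    (λ x≈x′ x∈ → null⇒¬apart (D._≈_.close x≈x′) (X⇒ x∈))
    (λ x∉ → mk≈ (¬X⇒ x∉))
  hasSlope⇔incident (x , y) (x′ , y′) (finite r) {X} {L} X? L? (X⇒ , ¬X⇒) (L⇒ , ¬L⇒) = mk⇔
    (λ (x≉x′ , e) → X-holds x≉x′ X? , λ l → null⇒¬apart (D._≈_.close e) (L⇒ l))
    (λ (x∈ , l∉) → (λ x≈x′ → null⇒¬apart (D._≈_.close x≈x′) (X⇒ x∈)) , mk≈ (¬L⇒ l∉))
    where
    X-holds : ¬ x ≈ x′ → Dec X → X
    X-holds x≉x′ (yes x∈) = x∈
    X-holds x≉x′ (no  x∉) = contradiction (mk≈ (¬X⇒ x∉)) x≉x′

  incident-cong : ∀ {b b′} → b ≡ b′ → ∀ {X L} → Incident b X L → Incident b′ X L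
  incident-cong refl h = h

  module _ {n k E : ℕ} (E-large : 4 ℕ.* (n ℕ.* suc k) ℕ.+ n ℕ.* n ℕ.< E) where

    private
      sum<E : ∀ i → sum (λ j → degrees {n} {k} j i) ℕ.< E
      sum<E i = ℕ.≤-<-trans (sum-degrees≤ {n} {k} i) E-large

    -- The `i`th approximations to all coordinates and slopes form the rational point `ρ i`, along
    -- which each form follows its real value. Once every value is known to be null or apart, the
    -- forms with apart value make up the support.
    representable⇒matches : ∀ (G : Graph n) → Representable G k →
      ¬ ¬ (Σ[ flags ∈ Subset k ] Σ[ W ∈ Subset (#forms n k) ]
        (Realizable (formsₚ {n} {k}) sum<E W × Matches G (mkCode flags W)))
    representable⇒matches G (m′ , P , S , f , iso) none = ¬¬-∀ decide λ dec → none (result dec)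
      where
      -- The points are pulled back along the isomorphism, so that the vertices of `G` label them.
      p : Fin n → Point
      p v = PointSet.point P (Inverse.to f v)
      x y : Fin n → ℝ
      x = proj₁ ∘ p
      y = proj₂ ∘ p
      s : Fin k → ℝ
      s t = value (SlopeSet.slope S t)
      z : Fin n → Fin n → Fin (suc k) → ℝ
      z v w zero    = x v D.- x w
      z v w (suc t) = (y w D.- y v) D.- s t D.* (x w D.- x v)
      ρ : ℕ → Fin (#vars n k) → ℚ
      ρ i j = [ (λ v → seq (x v) i) , (λ j′ → [ (λ v → seq (y v) i) , (λ t → seq (s t) i) ]′ (splitAt n j′)) ]′ (splitAt n j)
      ρ-x : ∀ i v → ρ i (xᵥ {n} {k} v) ≡ seq (x v) i
      ρ-x i v = cong [ _ , _ ]′ (Fin.splitAt-↑ˡ n v (n ℕ.+ k))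
      ρ-y : ∀ i v → ρ i (yᵥ {n} {k} v) ≡ seq (y v) i
      ρ-y i v = trans (cong [ _ , _ ]′ (Fin.splitAt-↑ʳ n (n ℕ.+ k) (v ↑ˡ k))) (cong [ _ , _ ]′ (Fin.splitAt-↑ˡ n v k))
      ρ-s : ∀ i t → ρ i (sᵥ {n} t) ≡ seq (s t) i
      ρ-s i t = trans (cong [ _ , _ ]′ (Fin.splitAt-↑ʳ n (n ℕ.+ k) (n ↑ʳ t))) (cong [ _ , _ ]′ (Fin.splitAt-↑ʳ n k t))
      form-ρ : ∀ v w t i → seq (z v w t) i ≡ form {n} {k} v w t (ρ i)
      form-ρ v w zero    i = sym (cong₂ _-_ (ρ-x i v) (ρ-x i w))
      form-ρ v w (suc t) i = sym (cong₂ _-_ (cong₂ _-_ (ρ-y i w) (ρ-y i v))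
        (cong₂ _*_ (ρ-s i t) (cong₂ _-_ (ρ-x i w) (ρ-x i v))))
      decide : ∀ j → ¬ ¬ (Null (seq (onDecoded z j)) ⊎ Apart (seq (onDecoded z j)))
      decide j = cauchy⇒¬¬null⊎apart (cauchy (onDecoded z j))
      forms-ρ : ∀ j i → seq (onDecoded z j) i ≡ forms {n} {k} j (ρ i)
      forms-ρ j i = let v , w , t = decode {n} {k} j in form-ρ v w t i

      module _ (dec : ∀ j → Null (seq (onDecoded z j)) ⊎ Apart (seq (onDecoded z j))) where
        flags : Subset k
        flags = Vec.tabulate (vertical ∘ SlopeSet.slope S)
        inside? : ∀ {a : Sequence} → Null a ⊎ Apart a → Bool
        inside? (inj₁ _) = false
        inside? (inj₂ _) = true
        W : Subset (#forms n k)
        W = Vec.tabulate (inside? ∘ dec)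
        W-decides : ∀ j → Decides (j ∈ W) (onDecoded z j)
        W-decides j = (λ j∈W → apart (dec j) (trans (sym (Vec.lookup∘tabulate (inside? ∘ dec) j)) (Vec.[]=⇒lookup j∈W)))
          , λ j∉W → null (dec j) λ e → j∉W (Vec.lookup⇒[]= j W (trans (Vec.lookup∘tabulate (inside? ∘ dec) j) e))
          where
          apart : ∀ {a : Sequence} (d : Null a ⊎ Apart a) → inside? d ≡ true → Apart a
          apart (inj₂ ap) _ = ap
          null : ∀ {a : Sequence} (d : Null a ⊎ Apart a) → inside? d ≢ true → Null a
          null (inj₁ nu) _  = nu
          null (inj₂ _)  ne = contradiction refl ne
        decides : ∀ v w t → Decides (index v w t ∈ W) (z v w t)
        decides v w t = subst (Decides (index v w t ∈ W)) (onDecoded-index z v w t) (W-decides (index v w t))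
        realizable : Realizable (formsₚ {n} {k}) sum<E W
        realizable = record
          { ρ       = ρ
          ; bounded = λ j → cauchy⇒bounded λ {ε} ε>0 → let N , h = cauchy (onDecoded z j) ε>0 in
              N , λ {i} {i′} hi hi′ → subst₂ (λ a b → ∣ a - b ∣ < ε) (forms-ρ j i) (forms-ρ j i′) (h hi hi′)
          ; apart   = λ j j∈W → apart-cong (forms-ρ j) (proj₁ (W-decides j) j∈W)
          ; null    = λ j j∉W → null-cong (forms-ρ j) (proj₂ (W-decides j) j∉W)
          }
        incident⇔ : ∀ v w t → HasSlope (p v) (p w) (SlopeSet.slope S t) ⇔
          Incident (vertical (SlopeSet.slope S t)) (index v w zero ∈ W) (index v w (suc t) ∈ W)
        incident⇔ v w t = hasSlope⇔incident (p v) (p w) (SlopeSet.slope S t)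
          (index v w zero Subset.∈? W) (index v w (suc t) Subset.∈? W) (decides v w zero) (decides v w (suc t))
        flag : ∀ t → Vec.lookup flags t ≡ vertical (SlopeSet.slope S t)
        flag = Vec.lookup∘tabulate (vertical ∘ SlopeSet.slope S)
        matches : Matches G (mkCode flags W)
        matches v w = mk⇔
          (λ v~w → let fv≢fw , t , h = Equivalence.to (iso v w) v~w in
            (λ v≡w → fv≢fw (cong (Inverse.to f) v≡w)) , t ,
            incident-cong (sym (flag t)) (Equivalence.to (incident⇔ v w t) h))
          (λ (v≢w , t , h) → Equivalence.from (iso v w)
            ( (λ fv≡fw → v≢w (Injection.injective (↔⇒↣ f) fv≡fw)) , t
            , Equivalence.from (incident⇔ v w t) (incident-cong (flag t) h)))
        result : Σ[ flags ∈ Subset k ] Σ[ W ∈ Subset (#forms n k) ]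
          (Realizable (formsₚ {n} {k}) sum<E W × Matches G (mkCode flags W))
        result = flags , W , realizable , matches

    -- There are `2 ^ k` choices of flags, each combined with every candidate support. The list is
    -- fixed before any graph is given.
    codes : Σ[ C ∈ List (Code n k) ] (length C ℕ.≤ 2 ℕ.^ k ℕ.* E ℕ.^ #vars n k ×
      (∀ (G : Graph n) → Representable G k → ¬ ¬ (∃[ c ] (c ∈ₗ C × Matches G c))))
    codes with realizable-cover (formsₚ {n} {k}) sum<E
    ... | L , len , complete = cartesianProductWith mkCode (allSubsets k) L
      , (begin
        length (cartesianProductWith mkCode (allSubsets k) L)   ≡⟨ length-cartesianProductWith mkCode (allSubsets k) L ⟩
        length (allSubsets k) ℕ.* length L           ≡⟨ cong (ℕ._* length L) (length-allSubsets k) ⟩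
        2 ℕ.^ k ℕ.* length L                         ≤⟨ ℕ.*-monoʳ-≤ (2 ℕ.^ k) len ⟩
        2 ℕ.^ k ℕ.* E ℕ.^ #vars n k                  ∎)
      , λ G rep none → representable⇒matches G rep λ (flags , W , R , M) →
          none (mkCode flags W , ∈-cartesianProductWith⁺ mkCode (∈-allSubsets flags) (complete R) , M)
      where open ℕ.≤-Reasoning

-- A large family of labelled regular graphs

module Lifts where

  open import Data.Empty using (⊥)
  open import Data.Fin.Base using (Fin; zero; suc; punchIn; punchOut; combine; remQuot; funToFin; finToFun)
  open import Data.Fin.Permutation as Perm using (Permutation′; _⟨$⟩ʳ_; _⟨$⟩ˡ_; insert; insert-punchIn)
  import Data.Fin.Properties as Fin
  open import Data.Fin.Subset using (Subset; inside; outside; _∈_; ∣_∣) renaming (⊥ to ∅)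
  import Data.Fin.Subset.Properties as Subset
  open import Data.Nat.Base using (ℕ; zero; suc; _+_; _*_; _^_; _!)
  open import Data.Product.Base using (Σ-syntax; ∃-syntax; _×_; _,_; proj₁; proj₂)
  open import Data.Product.Properties using (,-injectiveˡ; ,-injectiveʳ)
  open import Data.Sum.Base using (_⊎_; inj₁; inj₂)
  open import Data.Sum.Properties using (inj₁-injective; inj₂-injective)
  open import Data.Sum.Function.Propositional using (_⊎-↔_)
  open import Data.Vec.Base using (_∷_; here; there; _[_]≔_)
  import Data.Vec.Properties as Vec
  open import Function.Base using (_∘_)
  open import Function.Bundles using (_↔_; _⇔_; mk⇔; Equivalence; Inverse; Injection)
  open import Function.Construct.Composition using (_↔-∘_)
  open import Function.Construct.Symmetry using (↔-sym)
  open import Function.Definitions using (Injective)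
  open import Function.Properties.Inverse using (↔⇒↣)
  open import Relation.Binary.PropositionalEquality
  open import Relation.Nullary.Decidable using (yes; no)
  open import Relation.Nullary.Negation using (¬_; contradiction)

  open import Defs using (Graph; Adjacent; Regular)

  private
    variable
      m n Δ : ℕ

  ∣p[x]≔inside∣ : ∀ (p : Subset n) x → ¬ x ∈ p → ∣ p [ x ]≔ inside ∣ ≡ suc ∣ p ∣
  ∣p[x]≔inside∣ (outside ∷ p) zero    x∉p = refl
  ∣p[x]≔inside∣ (inside  ∷ p) zero    x∉p = contradiction here x∉p
  ∣p[x]≔inside∣ (outside ∷ p) (suc x) x∉p = ∣p[x]≔inside∣ p x (x∉p ∘ there)
  ∣p[x]≔inside∣ (inside  ∷ p) (suc x) x∉p = cong suc (∣p[x]≔inside∣ p x (x∉p ∘ there))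

  image : (Fin m → Fin n) → Subset n
  image {zero}  f = ∅
  image {suc m} f = image (f ∘ suc) [ f zero ]≔ inside

  ∈-image⁺ : ∀ (f : Fin m → Fin n) c → f c ∈ image f
  ∈-image⁺ f zero    = Vec.[]≔-updates (image (f ∘ suc)) (f zero)
  ∈-image⁺ f (suc c) with f zero Fin.≟ f (suc c)
  ... | yes e = subst (_∈ image f) e (Vec.[]≔-updates (image (f ∘ suc)) (f zero))
  ... | no ne = Vec.[]≔-minimal (image (f ∘ suc)) (f (suc c)) (f zero) (ne ∘ sym) (∈-image⁺ (f ∘ suc) c)

  ∈-image⁻ : ∀ (f : Fin m → Fin n) {w} → w ∈ image f → ∃[ c ] f c ≡ w
  ∈-image⁻ {zero}  f w∈ = contradiction w∈ Subset.∉⊥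
  ∈-image⁻ {suc m} f {w} w∈ with f zero Fin.≟ w
  ... | yes e = zero , e
  ... | no ne = let c , e = ∈-image⁻ (f ∘ suc) (Vec.lookup⇒[]= w _
                      (trans (sym (Vec.lookup∘updateAt′ w (f zero) (ne ∘ sym) (image (f ∘ suc)))) (Vec.[]=⇒lookup w∈)))
                in suc c , e

  ∣image∣ : ∀ (f : Fin m → Fin n) → Injective _≡_ _≡_ f → ∣ image f ∣ ≡ m
  ∣image∣ {zero}  {n} f f-inj = Subset.∣⊥∣≡0 n
  ∣image∣ {suc m} f f-inj = trans
    (∣p[x]≔inside∣ (image (f ∘ suc)) (f zero) λ f₀∈ →
      let c , e = ∈-image⁻ (f ∘ suc) f₀∈ in Fin.0≢1+n (sym (f-inj e)))
    (cong suc (∣image∣ (f ∘ suc) (Fin.suc-injective ∘ f-inj)))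

  regular : (G : Graph n) (nb : Fin n → Fin Δ → Fin n) → (∀ v → Injective _≡_ _≡_ (nb v)) →
    (∀ v w → (∃[ c ] nb v c ≡ w) ⇔ Adjacent G v w) → Regular Δ G
  regular G nb nb-inj nb⇔ v = image (nb v) , ∣image∣ (nb v) (nb-inj v) , λ w →
    mk⇔ (Equivalence.to (nb⇔ v w) ∘ ∈-image⁻ (nb v))
        (λ v~w → let c , e = Equivalence.from (nb⇔ v w) v~w in subst (_∈ image (nb v)) e (∈-image⁺ (nb v) c))

  -- The Lehmer code: the leading digit is the image of `zero`, and the rest codes the permutation
  -- induced on the other elements.
  permutation : ∀ m → Fin (m !) → Permutation′ m
  permutation zero    _ = Perm.id
  permutation (suc m) x = insert zero (proj₁ (remQuot (m !) x)) (permutation m (proj₂ (remQuot {suc m} (m !) x)))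

  -- The value at `zero` recovers the leading digit; once these agree, `punchIn` cancels from the
  -- remaining values.
  permutation-injective : ∀ m {x y} → (∀ i → permutation m x ⟨$⟩ʳ i ≡ permutation m y ⟨$⟩ʳ i) → x ≡ y
  permutation-injective zero    {zero} {zero} h = refl
  permutation-injective (suc m) {x} {y} h = begin
    x                                                                ≡⟨ Fin.combine-remQuot {suc m} (m !) x ⟨
    combine (proj₁ (remQuot (m !) x)) (proj₂ (remQuot {suc m} (m !) x))   ≡⟨ cong₂ combine (h zero) rest ⟩
    combine (proj₁ (remQuot (m !) y)) (proj₂ (remQuot {suc m} (m !) y))   ≡⟨ Fin.combine-remQuot {suc m} (m !) y ⟩
    y                                                                ∎
    where
    open ≡-Reasoning
    qx = proj₁ (remQuot {suc m} (m !) x)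
    qy = proj₁ (remQuot {suc m} (m !) y)
    σx = permutation m (proj₂ (remQuot {suc m} (m !) x))
    σy = permutation m (proj₂ (remQuot {suc m} (m !) y))
    rest = permutation-injective m λ i → Fin.punchIn-injective qx _ _ (begin
      punchIn qx (σx ⟨$⟩ʳ i)            ≡⟨ insert-punchIn zero qx σx i ⟨
      insert zero qx σx ⟨$⟩ʳ suc i      ≡⟨ h (suc i) ⟩
      insert zero qy σy ⟨$⟩ʳ suc i      ≡⟨ insert-punchIn zero qy σy i ⟩
      punchIn qy (σy ⟨$⟩ʳ i)            ≡⟨ cong (λ q → punchIn q (σy ⟨$⟩ʳ i)) (h zero) ⟨
      punchIn qx (σy ⟨$⟩ʳ i)            ∎)

  funToFin-cong : {f g : Fin m → Fin n} → f ≗ g → funToFin f ≡ funToFin g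
  funToFin-cong {zero}  f≗g = refl
  funToFin-cong {suc m} f≗g = cong₂ combine (f≗g zero) (funToFin-cong (f≗g ∘ suc))

  finToFun-injective : ∀ {x y : Fin (n ^ m)} → finToFun {n} {m} x ≗ finToFun y → x ≡ y
  finToFun-injective {n} {m} {x} {y} h = trans (sym (Fin.funToFin-finToFin {m} {n} x))
    (trans (funToFin-cong h) (Fin.funToFin-finToFin {m} {n} y))

  -- The disjoint union of a lift of K_{Δ,Δ} along the permutations π and of j copies of K_{Δ+1}.
  module _ (Δ m j : ℕ) where

    Vertex : Set
    Vertex = (Fin Δ × Fin m ⊎ Fin Δ × Fin m) ⊎ Fin j × Fin (suc Δ)

    #vertices : ℕ
    #vertices = (Δ * m + Δ * m) + j * suc Δ

    vertex : Fin #vertices ↔ Vertex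
    vertex = (((Fin.*↔× ⊎-↔ Fin.*↔×) ↔-∘ Fin.+↔⊎) ⊎-↔ Fin.*↔×) ↔-∘ Fin.+↔⊎

    pattern left a i  = inj₁ (inj₁ (a , i))
    pattern right c l = inj₁ (inj₂ (c , l))
    pattern copy b a  = inj₂ (b , a)

    Matchings : Set
    Matchings = Fin Δ → Fin Δ → Permutation′ m

    matchings : Fin ((m !) ^ (Δ * Δ)) → Matchings
    matchings x a c = permutation m (finToFun {m !} x (combine a c))

    matchings-injective : ∀ {x y} → (∀ a c i → matchings x a c ⟨$⟩ʳ i ≡ matchings y a c ⟨$⟩ʳ i) → x ≡ y
    matchings-injective {x} {y} h = finToFun-injective {m !} {Δ * Δ} λ k →
      subst (λ k → finToFun {m !} x k ≡ finToFun y k) (Fin.combine-remQuot {Δ} Δ k)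
        (permutation-injective m (h (proj₁ (remQuot Δ k)) (proj₂ (remQuot {Δ} Δ k))))

    module _ (π : Matchings) where

      -- Between the fibres over `a` and `c` the edges form the perfect matching given by `π a c`,
      -- so a left vertex has exactly one neighbour for each `c`, and a right vertex one for each
      -- `a`.
      Adj : Vertex → Vertex → Set
      Adj (left a i)  (right c l)  = π a c ⟨$⟩ʳ i ≡ l
      Adj (right c l) (left a i)   = π a c ⟨$⟩ʳ i ≡ l
      Adj (copy b a)  (copy b′ a′) = b ≡ b′ × a ≢ a′
      Adj _           _            = ⊥

      Adj-sym : ∀ x y → Adj x y → Adj y x
      Adj-sym (left a i)  (right c l)  h          = h
      Adj-sym (right c l) (left a i)   h          = h
      Adj-sym (copy b a)  (copy b′ a′) (e , ne)   = sym e , ne ∘ sym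

      Adj-irrefl : ∀ x → ¬ Adj x x
      Adj-irrefl (left a i)  ()
      Adj-irrefl (right c l) ()
      Adj-irrefl (copy b a)  (_ , ne) = ne refl

      neighbour : Vertex → Fin Δ → Vertex
      neighbour (left a i)  c = right c (π a c ⟨$⟩ʳ i)
      neighbour (right c l) a = left a (π a c ⟨$⟩ˡ l)
      neighbour (copy b a)  c = copy b (punchIn a c)

      neighbour-injective : ∀ x → Injective _≡_ _≡_ (neighbour x)
      neighbour-injective (left a i)  e = ,-injectiveˡ (inj₂-injective (inj₁-injective e))
      neighbour-injective (right c l) e = ,-injectiveˡ (inj₁-injective (inj₁-injective e))
      neighbour-injective (copy b a)  e = Fin.punchIn-injective a _ _ (,-injectiveʳ (inj₂-injective e))

      neighbour⇒Adj : ∀ x c → Adj x (neighbour x c)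
      neighbour⇒Adj (left a i)  c = refl
      neighbour⇒Adj (right c l) a = Perm.inverseʳ (π a c)
      neighbour⇒Adj (copy b a)  c = refl , Fin.punchInᵢ≢i a c ∘ sym

      Adj⇒neighbour : ∀ x y → Adj x y → ∃[ c ] neighbour x c ≡ y
      Adj⇒neighbour (left a i)  (right c l)   refl        = c , refl
      Adj⇒neighbour (right c l) (left a i)    refl        = a , cong (left a) (Perm.inverseˡ (π a c))
      Adj⇒neighbour (copy b a)  (copy .b a′) (refl , ne) = punchOut ne , cong (copy b) (Fin.punchIn-punchOut ne)

      private
        to   = Inverse.to vertex
        from = Inverse.from vertex

      lift : Graph #vertices
      lift = record
        { _~_      = λ v w → Adj (to v) (to w)
        ; ~-sym    = λ {v} {w} → Adj-sym (to v) (to w)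
        ; ~-irrefl = λ { {v} refl → Adj-irrefl (to v) }
        }

      lift-regular : Regular Δ lift
      lift-regular = regular lift (λ v c → from (neighbour (to v) c))
        (λ v e → neighbour-injective (to v) (Injection.injective (↔⇒↣ (↔-sym vertex)) e))
        (λ v w → mk⇔
          (λ { (c , refl) → subst (Adj (to v)) (sym (Inverse.strictlyInverseˡ vertex (neighbour (to v) c))) (neighbour⇒Adj (to v) c) })
          (λ v~w → let c , e = Adj⇒neighbour (to v) (to w) v~w in
            c , trans (cong from e) (Inverse.strictlyInverseʳ vertex w)))

    -- The neighbour of `left a i` in the fibre over `c` reads off the value of `π a c` at `i`.
    -- Graphs are compared as labelled graphs, as they are in `Matches`.
    lift-injective : ∀ π π′ → (∀ v w → Adjacent (lift π) v w ⇔ Adjacent (lift π′) v w) →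
      ∀ a c i → π a c ⟨$⟩ʳ i ≡ π′ a c ⟨$⟩ʳ i
    lift-injective π π′ same a c i = sym (subst₂ (Adj π′) (Inverse.strictlyInverseˡ vertex x) (Inverse.strictlyInverseˡ vertex y)
      (Equivalence.to (same (from x) (from y))
        (subst₂ (Adj π) (sym (Inverse.strictlyInverseˡ vertex x)) (sym (Inverse.strictlyInverseˡ vertex y)) refl)))
      where
      from = Inverse.from vertex
      x y : Vertex
      x = left a i
      y = right c (π a c ⟨$⟩ʳ i)

-- Arithmetic: numbers of vertices and the comparison of the two counts

module Counting where

  open import Data.Nat.Base
  open import Data.Nat.Properties
  open import Data.Nat.Divisibility using (_∣_; divides; ∣m+n∣m⇒∣n; ∣1⇒≡1)
  open import Data.Nat.DivMod using (m≡m%n+[m/n]*n; m%n<n)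
  open import Data.Nat.Primality using (euclidsLemma; prime[2])
  open import Data.Nat.Solver using (module +-*-Solver)
  open import Data.Product.Base using (Σ-syntax; ∃-syntax; _×_; _,_; proj₁; proj₂)
  open import Data.Sum.Base using (_⊎_; inj₁; inj₂)
  open import Relation.Binary.PropositionalEquality
  open import Relation.Nullary.Negation using (contradiction)

  open +-*-Solver using (solve; con; _:+_; _:*_; _:=_)

  even⊎odd : ∀ n → (∃[ t ] n ≡ 2 * t) ⊎ (∃[ t ] n ≡ suc (2 * t))
  even⊎odd zero = inj₁ (0 , refl)
  even⊎odd (suc n) with even⊎odd n
  ... | inj₁ (t , e) = inj₂ (t , cong suc e)
  ... | inj₂ (t , e) = inj₁ (suc t , trans (cong suc e) (sym (*-suc 2 t)))

  -- Copies of K_{Δ+1} realize every admissible residue modulo 2Δ.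
  residue : ∀ Δ r h → r < 2 * Δ → 2 ∣ Δ * (r + h * (2 * Δ)) →
    ∃[ j ] ∃[ s ] (j * suc Δ ≡ r + s * (2 * Δ) × s ≤ 2 * Δ)
  residue Δ r h r<2Δ 2∣Δn with even⊎odd r
  -- For even r take `j` = r, since r(Δ+1) = r + (r/2)·2Δ.
  ... | inj₁ (t , refl) = 2 * t , t
    , solve 2 (λ Δ t → con 2 :* t :* (con 1 :+ Δ) := con 2 :* t :+ t :* (con 2 :* Δ)) refl Δ t
    , ≤-trans (m≤n*m t 2) (<⇒≤ r<2Δ)
  -- For odd r the parity condition makes Δ even. Then `j` = r + Δ works: r + 1 + Δ is even and (r +
  -- Δ)(Δ + 1) = r + Δ(r + 1 + Δ).
  ... | inj₂ (t , refl) with euclidsLemma Δ _ prime[2] 2∣Δn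
  ...   | inj₁ (divides d refl) = suc (2 * t) + d * 2 , suc (t + d)
    , solve 2 (λ d t → (con 1 :+ con 2 :* t :+ d :* con 2) :* (con 1 :+ d :* con 2)
        := con 1 :+ con 2 :* t :+ (con 1 :+ (t :+ d)) :* (con 2 :* (d :* con 2))) refl d t
    , (begin
      suc (t + d)            ≤⟨ +-mono-≤ (*-cancelˡ-< 2 t (d * 2) (<-trans (n<1+n (2 * t)) r<2Δ)) (m≤m*n d 2) ⟩
      d * 2 + d * 2          ≡⟨ cong (d * 2 +_) (+-identityʳ (d * 2)) ⟨
      2 * (d * 2)            ∎)
    where open ≤-Reasoning
  ...   | inj₂ 2∣n = contradiction (∣1⇒≡1 2∣1) λ ()
    where
    2∣2t+h2Δ : 2 ∣ 2 * t + h * (2 * Δ)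
    2∣2t+h2Δ = divides (t + h * Δ)
      (solve 3 (λ t h Δ → con 2 :* t :+ h :* (con 2 :* Δ) := (t :+ h :* Δ) :* con 2) refl t h Δ)
    2∣1 : 2 ∣ 1
    2∣1 = ∣m+n∣m⇒∣n (subst (2 ∣_) (+-comm 1 (2 * t + h * (2 * Δ))) 2∣n) 2∣2t+h2Δ

  -- Write n = r + h·2Δ. The copies of K_{Δ+1} use up r and `s` of the h blocks of size 2Δ, and the
  -- other m = h - s blocks go into the lift. The size of n ensures h ≥ 2Δ ≥ s. The last inequality
  -- says that only a bounded part of n is lost.
  decompose : ∀ Δ n → 1 ≤ Δ → 2 ∣ Δ * n → 2 * Δ * (2 * Δ) ≤ n →
    ∃[ m ] ∃[ j ] (n ≡ (Δ * m + Δ * m) + j * suc Δ × n ≤ 2 * Δ * (m + suc (2 * Δ)))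
  decompose Δ@(suc _) n 1≤Δ 2∣Δn n-large with residue Δ (n % b) (n / b) (m%n<n n b)
      (subst (λ n → 2 ∣ Δ * n) (m≡m%n+[m/n]*n n b) 2∣Δn)
    where b = 2 * Δ
  ... | j , s , j≡ , s≤b = m , j
    , (begin-equality
      n                             ≡⟨ n≡ ⟩
      r + h * b                     ≡⟨ cong (λ h → r + h * b) h≡ ⟨
      r + (m + s) * b               ≡⟨ solve 4 (λ r m s Δ → r :+ (m :+ s) :* (con 2 :* Δ)
                                         := (Δ :* m :+ Δ :* m) :+ (r :+ s :* (con 2 :* Δ))) refl r m s Δ ⟩
      (Δ * m + Δ * m) + (r + s * b) ≡⟨ cong (Δ * m + Δ * m +_) j≡ ⟨
      (Δ * m + Δ * m) + j * suc Δ   ∎)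
    , (begin
      n                             ≡⟨ n≡ ⟩
      r + h * b                     ≤⟨ +-monoˡ-≤ (h * b) (<⇒≤ (m%n<n n b)) ⟩
      suc h * b                     ≡⟨ cong (λ h → suc h * b) h≡ ⟨
      suc (m + s) * b               ≤⟨ *-monoˡ-≤ b (s≤s (+-monoʳ-≤ m s≤b)) ⟩
      suc (m + b) * b               ≡⟨ cong (_* b) (+-suc m b) ⟨
      (m + suc b) * b               ≡⟨ *-comm (m + suc b) b ⟩
      b * (m + suc b)               ∎)
    where
    open ≤-Reasoning
    b = 2 * Δ
    r = n % b
    h = n / b
    m = h ∸ s
    n≡ : n ≡ r + h * b
    n≡ = m≡m%n+[m/n]*n n b
    b≤h : b ≤ h
    b≤h = s≤s⁻¹ (*-cancelʳ-< b b (suc h) (begin-strict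
      b * b         ≤⟨ n-large ⟩
      n             ≡⟨ n≡ ⟩
      r + h * b     <⟨ +-monoˡ-< (h * b) (m%n<n n b) ⟩
      suc h * b     ∎))
    h≡ : m + s ≡ h
    h≡ = m∸n+n≡m (≤-trans s≤b b≤h)

  ^-distribʳ-* : ∀ a b n → (a * b) ^ n ≡ a ^ n * b ^ n
  ^-distribʳ-* a b zero    = refl
  ^-distribʳ-* a b (suc n) = trans (cong (a * b *_) (^-distribʳ-* a b n))
    (solve 4 (λ a b x y → a :* b :* (x :* y) := a :* x :* (b :* y)) refl a b (a ^ n) (b ^ n))

  ^-cancelʳ-≤ : ∀ {a b} n .{{_ : NonZero n}} → a ^ n ≤ b ^ n → a ≤ b
  ^-cancelʳ-≤ {a} {b} n le = ≮⇒≥ λ b<a → <⇒≱ (^-monoˡ-< n b<a) le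

  ^-swap : ∀ a m n → (a ^ m) ^ n ≡ (a ^ n) ^ m
  ^-swap a m n = trans (^-*-assoc a m n) (trans (cong (a ^_) (*-comm m n)) (sym (^-*-assoc a n m)))

  n<2^n : ∀ n → n < 2 ^ n
  n<2^n zero    = s≤s z≤n
  n<2^n (suc n) = begin-strict
    suc n             <⟨ s≤s (n<2^n n) ⟩
    1 + 2 ^ n         ≤⟨ +-mono-≤ (m^n>0 2 n) (m≤m+n (2 ^ n) 0) ⟩
    2 ^ suc n         ∎
    where open ≤-Reasoning

  -- Each of the k factors from m + 1 to m + k is at least m.
  m^k*m!≤[k+m]! : ∀ m k → m ^ k * m ! ≤ (k + m) !
  m^k*m!≤[k+m]! m zero    = ≤-reflexive (+-identityʳ (m !))
  m^k*m!≤[k+m]! m (suc k) = begin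
    m * m ^ k * m !           ≡⟨ *-assoc m (m ^ k) (m !) ⟩
    m * (m ^ k * m !)         ≤⟨ *-mono-≤ (m≤n+m m (suc k)) (m^k*m!≤[k+m]! m k) ⟩
    (suc k + m) !             ∎
    where open ≤-Reasoning

  -- The bound 4^m on the central binomial coefficient. The step from m to m + 1 multiplies the left
  -- side by (2m+2)(2m+1), which is at most 4(m+1)².
  [m+m]!≤4^m*m!*m! : ∀ m → (m + m) ! ≤ 4 ^ m * (m ! * m !)
  [m+m]!≤4^m*m!*m! zero    = ≤-refl
  [m+m]!≤4^m*m!*m! (suc m) = begin
    (suc m + suc m) !                                     ≡⟨ cong (λ k → (suc k) !) (+-suc m m) ⟩
    suc (suc (m + m)) * (suc (m + m) * (m + m) !)         ≤⟨ *-monoʳ-≤ (suc (suc (m + m))) (*-mono-≤ (n≤1+n (suc (m + m))) ([m+m]!≤4^m*m!*m! m)) ⟩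
    suc (suc (m + m)) * (suc (suc (m + m)) * (4 ^ m * (m ! * m !)))
      ≡⟨ solve 3 (λ m p f → (con 2 :+ (m :+ m)) :* ((con 2 :+ (m :+ m)) :* (p :* (f :* f)))
           := con 4 :* p :* ((con 1 :+ m) :* f :* ((con 1 :+ m) :* f))) refl m (4 ^ m) (m !) ⟩
    4 ^ suc m * (suc m ! * suc m !)                       ∎
    where open ≤-Reasoning

  -- A weak Stirling estimate, obtained by comparing both sides, times m!, with (2m)!.
  m^m≤4^m*m! : ∀ m → m ^ m ≤ 4 ^ m * m !
  m^m≤4^m*m! m = *-cancelʳ-≤ (m ^ m) (4 ^ m * m !) (m !) {{m !≢0}} (begin
    m ^ m * m !            ≤⟨ m^k*m!≤[k+m]! m m ⟩
    (m + m) !              ≤⟨ [m+m]!≤4^m*m!*m! m ⟩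
    4 ^ m * (m ! * m !)    ≡⟨ *-assoc (4 ^ m) (m !) (m !) ⟨
    4 ^ m * m ! * m !      ∎)
    where open ≤-Reasoning

  -- After squaring, (D²)^m and m^(2p) are each at most m^m. Thus a single m^m absorbs an
  -- exponential factor and a fixed power of m.
  D^m*m^p≤m^m : ∀ D m p → 1 ≤ m → D * D ≤ m → p + p ≤ m → D ^ m * m ^ p ≤ m ^ m
  D^m*m^p≤m^m D m@(suc _) p 1≤m D²≤m 2p≤m = ^-cancelʳ-≤ 2 (begin
    (D ^ m * m ^ p) ^ 2
      ≡⟨ solve 2 (λ x y → (x :* y) :* (x :* y :* con 1) := (x :* x) :* (y :* y)) refl (D ^ m) (m ^ p) ⟩
    (D ^ m * D ^ m) * (m ^ p * m ^ p)
      ≡⟨ cong₂ _*_ (^-distribʳ-* D D m) (^-distribˡ-+-* m p p) ⟨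
    (D * D) ^ m * m ^ (p + p)
      ≤⟨ *-mono-≤ (^-monoˡ-≤ m D²≤m) (^-monoʳ-≤ m 2p≤m) ⟩
    m ^ m * m ^ m
      ≡⟨ cong (m ^ m *_) (*-identityʳ (m ^ m)) ⟨
    (m ^ m) ^ 2 ∎)
    where open ≤-Reasoning

  -- Multiplying by 4^(m(q+1)) allows m! to be traded for m^m. Of the q + 1 factors m^m, q match the
  -- left side; the last one absorbs the powers of 4 and of `B` and the excess m^(qc).
  factorial-bound : ∀ B q m c → 1 ≤ B → 1 ≤ m → c ≤ m →
    (4 ^ suc q * (B * B)) * (4 ^ suc q * (B * B)) ≤ m → q * c + q * c ≤ m →
    (B * m ^ q) ^ (m + c) ≤ (m !) ^ suc q
  factorial-bound B@(suc _) q m c 1≤B 1≤m c≤m D²≤m 2p≤m =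
    *-cancelˡ-≤ (4 ^ (m * suc q)) {{m^n≢0 4 (m * suc q)}} (begin
    4 ^ (m * suc q) * (B * m ^ q) ^ (m + c)
      ≡⟨ cong₂ _*_ (sym (^-*-assoc 4 m (suc q))) (^-distribʳ-* B (m ^ q) (m + c)) ⟩
    (4 ^ m) ^ suc q * (B ^ (m + c) * (m ^ q) ^ (m + c))
      ≤⟨ *-monoʳ-≤ ((4 ^ m) ^ suc q) (*-monoˡ-≤ ((m ^ q) ^ (m + c)) (^-monoʳ-≤ B (+-monoʳ-≤ m c≤m))) ⟩
    (4 ^ m) ^ suc q * (B ^ (m + m) * (m ^ q) ^ (m + c))
      ≡⟨ cong₂ _*_ (^-swap 4 m (suc q)) (cong₂ _*_
           (trans (^-distribˡ-+-* B m m) (sym (^-distribʳ-* B B m)))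
           (trans (^-distribˡ-+-* (m ^ q) m c) (cong₂ _*_ (^-swap m q m) (^-*-assoc m q c)))) ⟩
    (4 ^ suc q) ^ m * ((B * B) ^ m * ((m ^ m) ^ q * m ^ (q * c)))
      ≡⟨ solve 4 (λ x y z w → x :* (y :* (z :* w)) := (x :* y) :* w :* z) refl
           ((4 ^ suc q) ^ m) ((B * B) ^ m) ((m ^ m) ^ q) (m ^ (q * c)) ⟩
    (4 ^ suc q) ^ m * (B * B) ^ m * m ^ (q * c) * (m ^ m) ^ q
      ≡⟨ cong (λ z → z * m ^ (q * c) * (m ^ m) ^ q) (^-distribʳ-* (4 ^ suc q) (B * B) m) ⟨
    D ^ m * m ^ (q * c) * (m ^ m) ^ q
      ≤⟨ *-monoˡ-≤ ((m ^ m) ^ q) (D^m*m^p≤m^m D m (q * c) 1≤m D²≤m 2p≤m) ⟩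
    (m ^ m) ^ suc q
      ≤⟨ ^-monoˡ-≤ (suc q) (m^m≤4^m*m! m) ⟩
    (4 ^ m * m !) ^ suc q
      ≡⟨ trans (^-distribʳ-* (4 ^ m) (m !) (suc q)) (cong (_* (m !) ^ suc q) (^-*-assoc 4 m (suc q))) ⟩
    4 ^ (m * suc q) * (m !) ^ suc q ∎)
    where
    open ≤-Reasoning
    D = 4 ^ suc q * (B * B)

  -- The condition k < ¼ ((1 − 1/q) Δ − 8) n, free of fractions and subtractions.
  Admissible : ℕ → ℕ → ℕ → ℕ → Set
  Admissible Δ q n k = 4 * q * k + 8 * q * n + Δ * n < q * Δ * n

  -- For suc q, cancelling Δn turns admissibility into 4(q+1)(2n+k) < qΔn, a bound on the number of
  -- unknowns. The cruder bounds by Δn follow from it.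
  admissible⇒#vars : ∀ Δ q n k → Admissible Δ (suc q) n k →
    (n + (n + k)) * (4 * suc q) ≤ q * n * Δ × n + (n + k) ≤ Δ * n × k < Δ * n
  admissible⇒#vars Δ q n k adm = bound , N≤Δn , ≤-<-trans (m≤n+m k (n + n)) (subst (_< Δ * n) (sym (+-assoc n n k)) N<Δn)
    where
    open ≤-Reasoning
    N = n + (n + k)
    rearranged : N * (4 * suc q) + Δ * n < q * n * Δ + Δ * n
    rearranged = subst₂ _<_
      (solve 4 (λ q k n Δ → con 4 :* (con 1 :+ q) :* k :+ con 8 :* (con 1 :+ q) :* n :+ Δ :* n
        := (n :+ (n :+ k)) :* (con 4 :* (con 1 :+ q)) :+ Δ :* n) refl q k n Δ)
      (solve 3 (λ q n Δ → (con 1 :+ q) :* Δ :* n := q :* n :* Δ :+ Δ :* n) refl q n Δ) adm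
    bound< : N * (4 * suc q) < q * n * Δ
    bound< = +-cancelʳ-< (Δ * n) (N * (4 * suc q)) (q * n * Δ) rearranged
    bound = <⇒≤ bound<
    N<Δn : N < Δ * n
    N<Δn = *-cancelʳ-< (suc q) N (Δ * n) (begin-strict
      N * suc q          ≤⟨ *-monoʳ-≤ N (m≤n*m (suc q) 4) ⟩
      N * (4 * suc q)    <⟨ bound< ⟩
      q * n * Δ          ≤⟨ *-monoˡ-≤ Δ (*-monoˡ-≤ n (n≤1+n q)) ⟩
      suc q * n * Δ      ≡⟨ solve 3 (λ q n Δ → (con 1 :+ q) :* n :* Δ := Δ :* n :* (con 1 :+ q)) refl q n Δ ⟩
      Δ * n * suc q      ∎)
    N≤Δn = <⇒≤ N<Δn

  module _ (Δ q : ℕ) where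

    -- `A` collects the bases of the factors exponential in n: 24Δ is 2·2·6Δ, from `suc (Δ * n)`,
    -- `2 ^ k` and the 6Δ in the degree bound. `B` also pays for replacing n by 4Δm, `c` is the loss
    -- in `decompose`, and `threshold` lets m dominate the three quantities required by
    -- `factorial-bound`.
    A B D c threshold : ℕ
    A = (24 * Δ) ^ (2 * suc q)
    B = A * (2 * (2 * Δ)) ^ q
    D = 4 ^ suc q * (B * B)
    c = suc (2 * Δ)
    threshold = D * D + (q * c + q * c) + c

    -- From n ≤ 2Δ(m+c) ≤ 4Δm, the base A·n^q is at most B·m^q and the exponent n at most 2Δ(m+c);
    -- the rest is `factorial-bound` raised to the power 2Δ.
    family-bound : ∀ n m → 1 ≤ Δ → 1 ≤ n → n ≤ 2 * Δ * (m + c) → threshold ≤ m →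
      A ^ n * n ^ (q * n) ≤ ((m !) ^ (Δ * 2)) ^ suc q
    family-bound n@(suc _) m 1≤Δ 1≤n n≤ large = begin
      A ^ n * n ^ (q * n)
        ≡⟨ trans (cong (A ^ n *_) (sym (^-*-assoc n q n))) (sym (^-distribʳ-* A (n ^ q) n)) ⟩
      (A * n ^ q) ^ n
        ≤⟨ ^-monoʳ-≤ (A * n ^ q) {{m*n≢0 A (n ^ q) {{A≢0}} {{m^n≢0 n q}}}} n≤ ⟩
      (A * n ^ q) ^ (2 * Δ * (m + c))
        ≤⟨ ^-monoˡ-≤ (2 * Δ * (m + c)) (begin
          A * n ^ q                         ≤⟨ *-monoʳ-≤ A (^-monoˡ-≤ q n≤2bm) ⟩
          A * (2 * (2 * Δ) * m) ^ q         ≡⟨ cong (A *_) (^-distribʳ-* (2 * (2 * Δ)) m q) ⟩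
          A * ((2 * (2 * Δ)) ^ q * m ^ q)   ≡⟨ *-assoc A ((2 * (2 * Δ)) ^ q) (m ^ q) ⟨
          B * m ^ q                         ∎) ⟩
      (B * m ^ q) ^ (2 * Δ * (m + c))
        ≡⟨ trans (cong ((B * m ^ q) ^_) (*-comm (2 * Δ) (m + c))) (sym (^-*-assoc (B * m ^ q) (m + c) (2 * Δ))) ⟩
      ((B * m ^ q) ^ (m + c)) ^ (2 * Δ)
        ≤⟨ ^-monoˡ-≤ (2 * Δ) (factorial-bound B q m c 1≤B 1≤m c≤m D²≤m 2p≤m) ⟩
      ((m !) ^ suc q) ^ (2 * Δ)
        ≡⟨ trans (^-swap (m !) (suc q) (2 * Δ)) (cong (λ e → ((m !) ^ e) ^ suc q) (*-comm 2 Δ)) ⟩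
      ((m !) ^ (Δ * 2)) ^ suc q ∎
      where
      open ≤-Reasoning
      instance
        Δ≢0 : NonZero Δ
        Δ≢0 = >-nonZero 1≤Δ
        24Δ≢0 : NonZero (24 * Δ)
        24Δ≢0 = m*n≢0 24 Δ
        4Δ≢0 : NonZero (2 * (2 * Δ))
        4Δ≢0 = m*n≢0 2 (2 * Δ) {{_}} {{m*n≢0 2 Δ}}
      A≢0 : NonZero A
      A≢0 = m^n≢0 (24 * Δ) (2 * suc q)
      1≤B : 1 ≤ B
      1≤B = >-nonZero⁻¹ B {{m*n≢0 A _ {{A≢0}} {{m^n≢0 (2 * (2 * Δ)) q}}}}
      c≤m : c ≤ m
      c≤m = ≤-trans (m≤n+m c (D * D + (q * c + q * c))) large
      1≤m : 1 ≤ m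
      1≤m = ≤-trans (s≤s z≤n) c≤m
      D²≤m : D * D ≤ m
      D²≤m = ≤-trans (m≤m+n (D * D) (q * c + q * c)) (m+n≤o⇒m≤o _ large)
      2p≤m : q * c + q * c ≤ m
      2p≤m = ≤-trans (m≤n+m (q * c + q * c) (D * D)) (m+n≤o⇒m≤o _ large)
      n≤2bm : n ≤ 2 * (2 * Δ) * m
      n≤2bm = begin
        n                       ≤⟨ n≤ ⟩
        2 * Δ * (m + c)         ≤⟨ *-monoʳ-≤ (2 * Δ) (+-monoʳ-≤ m c≤m) ⟩
        2 * Δ * (m + m)         ≡⟨ solve 2 (λ Δ m → con 2 :* Δ :* (m :+ m) := con 2 :* (con 2 :* Δ) :* m) refl Δ m ⟩
        2 * (2 * Δ) * m         ∎

    -- The power 2(q+1) clears the denominators of (1 - 1/(q+1))/2. The exponent of n on the left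
    -- becomes 4(q+1)(2n+k), which admissibility bounds by qnΔ, and `family-bound` to the power Δ
    -- finishes. The factor `suc (Δ * n)` leaves room for adding up over all k below Δn.
    count : ∀ n m k → 1 ≤ Δ → 1 ≤ n → n ≤ 2 * Δ * (m + c) → threshold ≤ m → Admissible Δ (suc q) n k →
      suc (Δ * n) * (2 ^ k * (6 * Δ * (n * n)) ^ (n + (n + k))) ≤ (m !) ^ (Δ * Δ)
    count n@(suc _) m k 1≤Δ 1≤n n≤ large adm = ^-cancelʳ-≤ (2 * suc q) (begin
      (suc (Δ * n) * (2 ^ k * (6 * Δ * (n * n)) ^ N)) ^ (2 * suc q)
        ≤⟨ ^-monoˡ-≤ (2 * suc q) (begin
          suc (Δ * n) * (2 ^ k * (6 * Δ * (n * n)) ^ N)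
            ≡⟨ cong (λ z → suc (Δ * n) * (2 ^ k * z)) (^-distribʳ-* (6 * Δ) (n * n) N) ⟩
          suc (Δ * n) * (2 ^ k * ((6 * Δ) ^ N * (n * n) ^ N))
            ≤⟨ *-mono-≤ (n<2^n (Δ * n)) (*-mono-≤ (^-monoʳ-≤ 2 (<⇒≤ k<Δn)) (*-monoˡ-≤ ((n * n) ^ N) (^-monoʳ-≤ (6 * Δ) N≤Δn))) ⟩
          2 ^ (Δ * n) * (2 ^ (Δ * n) * ((6 * Δ) ^ (Δ * n) * (n * n) ^ N))
            ≡⟨ solve 3 (λ x y z → x :* (x :* (y :* z)) := x :* x :* y :* z) refl (2 ^ (Δ * n)) ((6 * Δ) ^ (Δ * n)) ((n * n) ^ N) ⟩
          2 ^ (Δ * n) * 2 ^ (Δ * n) * (6 * Δ) ^ (Δ * n) * (n * n) ^ N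
            ≡⟨ cong (_* (n * n) ^ N) (trans (cong (_* (6 * Δ) ^ (Δ * n)) (sym (^-distribʳ-* 2 2 (Δ * n)))) (sym (^-distribʳ-* 4 (6 * Δ) (Δ * n)))) ⟩
          (4 * (6 * Δ)) ^ (Δ * n) * (n * n) ^ N
            ≡⟨ cong₂ (λ x y → x ^ (Δ * n) * y) (sym (*-assoc 4 6 Δ)) (trans (^-distribʳ-* n n N) (trans (sym (^-distribˡ-+-* n N N)) (cong (λ e → n ^ (N + e)) (sym (+-identityʳ N))))) ⟩
          (24 * Δ) ^ (Δ * n) * n ^ (2 * N) ∎) ⟩
      ((24 * Δ) ^ (Δ * n) * n ^ (2 * N)) ^ (2 * suc q)
        ≡⟨ ^-distribʳ-* ((24 * Δ) ^ (Δ * n)) (n ^ (2 * N)) (2 * suc q) ⟩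
      ((24 * Δ) ^ (Δ * n)) ^ (2 * suc q) * (n ^ (2 * N)) ^ (2 * suc q)
        ≡⟨ cong₂ _*_ (trans (^-swap (24 * Δ) (Δ * n) (2 * suc q)) (trans (cong (A ^_) (*-comm Δ n)) (sym (^-*-assoc A n Δ))))
             (trans (^-*-assoc n (2 * N) (2 * suc q)) (cong (n ^_) exponent)) ⟩
      (A ^ n) ^ Δ * n ^ (N * (4 * suc q))
        ≤⟨ *-monoʳ-≤ ((A ^ n) ^ Δ) (^-monoʳ-≤ n bound) ⟩
      (A ^ n) ^ Δ * n ^ (q * n * Δ)
        ≡⟨ trans (cong ((A ^ n) ^ Δ *_) (sym (^-*-assoc n (q * n) Δ))) (sym (^-distribʳ-* (A ^ n) (n ^ (q * n)) Δ)) ⟩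
      (A ^ n * n ^ (q * n)) ^ Δ
        ≤⟨ ^-monoˡ-≤ Δ (family-bound n m 1≤Δ 1≤n n≤ large) ⟩
      (((m !) ^ (Δ * 2)) ^ suc q) ^ Δ
        ≡⟨ trans (cong (_^ Δ) (^-*-assoc (m !) (Δ * 2) (suc q))) (trans (^-*-assoc (m !) (Δ * 2 * suc q) Δ)
             (trans (cong ((m !) ^_) (solve 2 (λ Δ q → Δ :* con 2 :* (con 1 :+ q) :* Δ := Δ :* Δ :* (con 2 :* (con 1 :+ q))) refl Δ q))
               (sym (^-*-assoc (m !) (Δ * Δ) (2 * suc q))))) ⟩
      ((m !) ^ (Δ * Δ)) ^ (2 * suc q) ∎)
      where
      open ≤-Reasoning
      N = n + (n + k)
      bounds = admissible⇒#vars Δ q n k adm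
      bound = proj₁ bounds
      N≤Δn = proj₁ (proj₂ bounds)
      k<Δn = proj₂ (proj₂ bounds)
      exponent : 2 * N * (2 * suc q) ≡ N * (4 * suc q)
      exponent = solve 2 (λ N q → con 2 :* N :* (con 2 :* (con 1 :+ q)) := N :* (con 4 :* (con 1 :+ q))) refl N q
      instance
        6Δ≢0 : NonZero (6 * Δ)
        6Δ≢0 = m*n≢0 6 Δ {{_}} {{>-nonZero 1≤Δ}}

  -- Justifies E = 6Δn² as a strict bound on the degrees of the products: for k < Δn these are at
  -- most 5Δn².
  E-large : ∀ Δ n k → 1 ≤ Δ → 1 ≤ n → k < Δ * n → 4 * (n * suc k) + n * n < 6 * Δ * (n * n)
  E-large Δ n k 1≤Δ 1≤n k<Δn = begin-strict
    4 * (n * suc k) + n * n               ≤⟨ +-mono-≤ (*-monoʳ-≤ 4 (*-monoʳ-≤ n k<Δn)) (m≤n*m (n * n) Δ) ⟩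
    4 * (n * (Δ * n)) + Δ * (n * n)       ≡⟨ solve 2 (λ Δ n → con 4 :* (n :* (Δ :* n)) :+ Δ :* (n :* n) := con 5 :* (Δ :* (n :* n))) refl Δ n ⟩
    5 * (Δ * (n * n))                     <⟨ *-monoˡ-< (Δ * (n * n)) (n<1+n 5) ⟩
    6 * (Δ * (n * n))                     ≡⟨ *-assoc 6 Δ (n * n) ⟨
    6 * Δ * (n * n)                       ∎
    where
    open ≤-Reasoning
    instance
      Δ≢0 : NonZero Δ
      Δ≢0 = >-nonZero 1≤Δ
      n≢0 : NonZero n
      n≢0 = >-nonZero 1≤n
      Δn²≢0 : NonZero (Δ * (n * n))
      Δn²≢0 = m*n≢0 Δ (n * n) {{Δ≢0}} {{m*n≢0 n n}}

-- A regular graph that fits no code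

module Escape where

  open import Data.Fin.Base using (Fin)
  import Data.Fin.Properties as Fin
  open import Data.List.Base using (List; []; _∷_; length; map; concatMap; upTo; lookup)
  import Data.List.Properties as List
  open import Data.List.Membership.Propositional using (_∈_; lose)
  open import Data.List.Membership.Propositional.Properties using (∈-map⁺; ∈-concatMap⁺; ∈-upTo⁺)
  open import Data.List.Relation.Unary.Any as Any using (Any)
  open import Data.List.Relation.Unary.Any.Properties using (lookup-index)
  open import Data.Nat.Base
  open import Data.Nat.Properties
  open import Data.Product.Base using (Σ-syntax; ∃-syntax; _×_; _,_; proj₁; proj₂)
  open import Function.Bundles using (mk⇔; Equivalence)
  open import Function.Construct.Composition using (_⇔-∘_)
  open import Function.Construct.Symmetry using (⇔-sym)
  open import Relation.Binary.Definitions using (Decidable)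
  open import Relation.Binary.PropositionalEquality
  open import Relation.Nullary.Decidable using (Dec; yes; no; ¬?; map′; _×-dec_; _→-dec_; decidable-stable)
  open import Relation.Nullary.Negation using (¬_; contradiction)

  open import Defs using (Graph; Adjacent; Regular; Representable; regular⇒decidable)
  open SlopeCodes using (Code; Matches; codeAdjacent?; codes)
  open Lifts using (#vertices; matchings; matchings-injective; lift; lift-regular; lift-injective)
  open Counting

  -- The factor `a` replaces division: every piece has length at most b/a.
  length-concatMap-≤ : ∀ {A B : Set} (f : A → List B) a b → (∀ x → a * length (f x) ≤ b) →
    ∀ xs → a * length (concatMap f xs) ≤ length xs * b
  length-concatMap-≤ f a b h []       = ≤-reflexive (*-zeroʳ a)
  length-concatMap-≤ f a b h (x ∷ xs) = begin
    a * length (concatMap f (x ∷ xs))                 ≡⟨ cong (a *_) (List.length-++ (f x)) ⟩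
    a * (length (f x) + length (concatMap f xs))      ≡⟨ *-distribˡ-+ a (length (f x)) _ ⟩
    a * length (f x) + a * length (concatMap f xs)    ≤⟨ +-mono-≤ (h x) (length-concatMap-≤ f a b h xs) ⟩
    b + length xs * b                                 ∎
    where open ≤-Reasoning

  -- Pigeonhole: if every x had a code in the list, the positions of these codes would embed `Fin T`
  -- into a smaller set. As `R` is decidable, the exceptional x is found by search.
  escape : ∀ {T} {C : Set} (cs : List C) → length cs < T → {R : Fin T → C → Set} →
    (∀ x c → Dec (R x c)) → (∀ {x y} c → R x c → R y c → x ≡ y) →
    ∃[ x ] (∀ {c} → c ∈ cs → ¬ R x c)
  escape {T} cs small {R} R? functional with Fin.any? (λ x → ¬? (Any.any? (R? x) cs))
  ... | yes (x , none) = x , λ c∈ r → none (lose c∈ r)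
  ... | no  all        = contradiction (Fin.injective⇒≤ coincide) (<⇒≱ small)
    where
    coded : ∀ x → Any (R x) cs
    coded x = decidable-stable (Any.any? (R? x) cs) λ none → all (x , none)
    code : Fin T → Fin (length cs)
    code x = Any.index (coded x)
    coincide : ∀ {x y} → code x ≡ code y → x ≡ y
    coincide {x} {y} same = functional (lookup cs (code y))
      (subst (λ i → R x (lookup cs i)) same (lookup-index (coded x))) (lookup-index (coded y))

  matches? : ∀ {n k} {G : Graph n} → Decidable (Adjacent G) → (c : Code n k) → Dec (Matches G c)
  matches? _~?_ c = Fin.all? λ v → Fin.all? λ w →
    map′ (λ (to , from) → mk⇔ to from) (λ e → Equivalence.to e , Equivalence.from e)
      (((v ~? w) →-dec codeAdjacent? c v w) ×-dec (codeAdjacent? c v w →-dec (v ~? w)))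

  AnyCode : ℕ → Set
  AnyCode n = Σ[ k ∈ ℕ ] Code n k

  tag : ∀ {n} k → Code n k → AnyCode n
  tag k c = k , c

  module _ (Δ q m j : ℕ) (1≤Δ : 1 ≤ Δ) (1≤n : 1 ≤ #vertices Δ m j)
    (n≤ : #vertices Δ m j ≤ 2 * Δ * (m + c Δ q)) (large : threshold Δ q ≤ m) where

    private
      n T : ℕ
      n = #vertices Δ m j
      T = (m !) ^ (Δ * Δ)

      admissible? : ∀ k → Dec (Admissible Δ (suc q) n k)
      admissible? k = _ <? _

      codesFor : ∀ k → Admissible Δ (suc q) n k → Σ[ C ∈ List (Code n k) ]
        (length C ≤ 2 ^ k * (6 * Δ * (n * n)) ^ (n + (n + k)) ×
        (∀ (G : Graph n) → Representable G k → ¬ ¬ (∃[ c ] (c ∈ C × Matches G c))))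
      codesFor k adm = codes (E-large Δ n k 1≤Δ 1≤n (proj₂ (proj₂ (admissible⇒#vars Δ q n k adm))))

      admissibleCodes : ∀ k → Dec (Admissible Δ (suc q) n k) → List (AnyCode n)
      admissibleCodes k (yes adm) = map (tag k) (proj₁ (codesFor k adm))
      admissibleCodes k (no _)    = []

      length-admissibleCodes : ∀ k a → suc (Δ * n) * length (admissibleCodes k a) ≤ T
      length-admissibleCodes k (no _)    = ≤-trans (≤-reflexive (*-zeroʳ (suc (Δ * n)))) z≤n
      length-admissibleCodes k (yes adm) = ≤-trans
        (*-monoʳ-≤ (suc (Δ * n)) (≤-trans (≤-reflexive (List.length-map (tag k) (proj₁ (codesFor k adm)))) (proj₁ (proj₂ (codesFor k adm)))))
        (count Δ q n m k 1≤Δ 1≤n n≤ large adm)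

      allCodes : List (AnyCode n)
      allCodes = concatMap (λ k → admissibleCodes k (admissible? k)) (upTo (Δ * n))

      length-allCodes : length allCodes < T
      -- There are Δn values of k, and each contributes at most T/(Δn+1) codes.
      length-allCodes = *-cancelˡ-< (suc (Δ * n)) (length allCodes) T (begin-strict
        suc (Δ * n) * length allCodes   ≤⟨ length-concatMap-≤ _ (suc (Δ * n)) T (λ k → length-admissibleCodes k (admissible? k)) (upTo (Δ * n)) ⟩
        length (upTo (Δ * n)) * T       ≡⟨ cong (_* T) (List.length-upTo (Δ * n)) ⟩
        Δ * n * T                       <⟨ *-monoˡ-< T {{m^n≢0 (m !) (Δ * Δ) {{m !≢0}}}} (n<1+n (Δ * n)) ⟩
        suc (Δ * n) * T                 ∎)
        where open ≤-Reasoning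

      G : Fin T → Graph n
      G x = lift Δ m j (matchings Δ m j x)

      G-regular : ∀ x → Regular Δ (G x)
      G-regular x = lift-regular Δ m j (matchings Δ m j x)

      escaping : ∃[ x ] (∀ {c} → c ∈ allCodes → ¬ Matches (G x) (proj₂ c))
      escaping = escape allCodes length-allCodes {λ x c → Matches (G x) (proj₂ c)}
        (λ x c → matches? {G = G x} (regular⇒decidable (G x) (G-regular x)) (proj₂ c))
        (λ {x} {y} _ M M′ → matchings-injective Δ m j
          (lift-injective Δ m j (matchings Δ m j x) (matchings Δ m j y)
            (λ v w → ⇔-sym (M′ v w) ⇔-∘ M v w)))

    -- The graph is chosen before k, avoiding the codes of all admissible k together. A
    -- representation yields a code only up to double negation, which suffices because a
    -- contradiction is sought.
    manySlopes : Σ[ G ∈ Graph n ] (Regular Δ G × (∀ k → Representable G k → ¬ Admissible Δ (suc q) n k))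
    manySlopes = let x , avoid = escaping in G x , G-regular x , λ k rep adm →
      proj₂ (proj₂ (codesFor k adm)) (G x) rep λ (c , c∈ , M) → avoid (member k adm c∈) M
      where
      member : ∀ k adm {c} → c ∈ proj₁ (codesFor k adm) → tag k c ∈ allCodes
      member k adm {c} c∈ = ∈-concatMap⁺ _ (lose (∈-upTo⁺ k<Δn) (go (admissible? k)))
        where
        k<Δn = proj₂ (proj₂ (admissible⇒#vars Δ q n k adm))
        go : ∀ a → tag k c ∈ admissibleCodes k a
        -- The list `codesFor` depends on the proof of admissibility, and `admissible?` may return
        -- another one; proofs of `<` are all equal.
        go (yes adm′) = ∈-map⁺ (tag k) (subst (λ a → c ∈ proj₁ (codesFor k a)) (<-irrelevant adm adm′) c∈)
        go (no ¬adm)  = contradiction adm ¬adm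

-- From natural to rational inequalities

module Rationals where

  import Data.Integer.Base as ℤ
  import Data.Integer.Properties as ℤ
  open import Data.Nat.Base as ℕ using (ℕ; suc)
  import Data.Nat.Properties as ℕ
  open import Data.Product.Base using (∃-syntax; _,_)
  open import Data.Rational.Base
  open import Data.Rational.Properties
  open import Data.Rational.Solver using (module +-*-Solver)
  open import Data.Rational.Unnormalised.Base as ℚᵘ using (mkℚᵘ; *≡*; *≤*)
  import Data.Rational.Unnormalised.Properties as ℚᵘ
  open import Relation.Binary.PropositionalEquality

  open Sequences using (*-pos)

  -- The rational that `fromℕ` embeds.
  ι : ℕ → ℚ
  ι n = ℤ.+ n / 1

  -- Since `_/_` normalizes its fraction, `ι` is handled through the unnormalised rationals, where
  -- the denominator is simply 1.
  toℚᵘ-ι : ∀ n → toℚᵘ (ι n) ℚᵘ.≃ mkℚᵘ (ℤ.+ n) 0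
  toℚᵘ-ι n = toℚᵘ-fromℚᵘ (mkℚᵘ (ℤ.+ n) 0)

  ι-+ : ∀ m n → ι (m ℕ.+ n) ≡ ι m + ι n
  ι-+ m n = toℚᵘ-injective (begin
    toℚᵘ (ι (m ℕ.+ n))                          ≈⟨ toℚᵘ-ι (m ℕ.+ n) ⟩
    mkℚᵘ (ℤ.+ (m ℕ.+ n)) 0                      ≈⟨ *≡* (cong (ℤ._* ℤ.+ 1) (sym (cong₂ ℤ._+_ (ℤ.*-identityʳ (ℤ.+ m)) (ℤ.*-identityʳ (ℤ.+ n))))) ⟩
    mkℚᵘ (ℤ.+ m) 0 ℚᵘ.+ mkℚᵘ (ℤ.+ n) 0          ≈⟨ ℚᵘ.+-cong (toℚᵘ-ι m) (toℚᵘ-ι n) ⟨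
    toℚᵘ (ι m) ℚᵘ.+ toℚᵘ (ι n)                  ≈⟨ toℚᵘ-homo-+ (ι m) (ι n) ⟨
    toℚᵘ (ι m + ι n)                            ∎)
    where open ℚᵘ.≃-Reasoning

  ι-* : ∀ m n → ι (m ℕ.* n) ≡ ι m * ι n
  ι-* m n = toℚᵘ-injective (begin
    toℚᵘ (ι (m ℕ.* n))                          ≈⟨ toℚᵘ-ι (m ℕ.* n) ⟩
    mkℚᵘ (ℤ.+ (m ℕ.* n)) 0                      ≈⟨ *≡* (cong (ℤ._* ℤ.+ 1) (ℤ.pos-* m n)) ⟩
    mkℚᵘ (ℤ.+ m) 0 ℚᵘ.* mkℚᵘ (ℤ.+ n) 0          ≈⟨ ℚᵘ.*-cong (toℚᵘ-ι m) (toℚᵘ-ι n) ⟨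
    toℚᵘ (ι m) ℚᵘ.* toℚᵘ (ι n)                  ≈⟨ toℚᵘ-homo-* (ι m) (ι n) ⟨
    toℚᵘ (ι m * ι n)                            ∎)
    where open ℚᵘ.≃-Reasoning

  ι-mono-≤ : ∀ {m n} → m ℕ.≤ n → ι m ≤ ι n
  ι-mono-≤ {m} {n} m≤n = toℚᵘ-cancel-≤ (begin
    toℚᵘ (ι m)        ≃⟨ toℚᵘ-ι m ⟩
    mkℚᵘ (ℤ.+ m) 0    ≤⟨ *≤* (ℤ.*-monoʳ-≤-nonNeg (ℤ.+ 1) (ℤ.+≤+ m≤n)) ⟩
    mkℚᵘ (ℤ.+ n) 0    ≃⟨ toℚᵘ-ι n ⟨
    toℚᵘ (ι n)        ∎)
    where open ℚᵘ.≤-Reasoning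

  ι-pos : ∀ {n} → 1 ℕ.≤ n → 0ℚ < ι n
  ι-pos 1≤n = <-≤-trans (positive⁻¹ 1ℚ) (ι-mono-≤ 1≤n)

  -- If γ is (a+1)/(d+1), then q = d works, as γ(d+1) = a + 1.
  archimedean : ∀ γ → 0ℚ < γ → ∃[ q ] 1ℚ ≤ γ * ι (suc q)
  archimedean γ γ>0 = go γ (positive γ>0)
    where
    go : ∀ γ → Positive γ → ∃[ q ] 1ℚ ≤ γ * ι (suc q)
    go (mkℚ (ℤ.+ 0) _ _) record { pos = () }
    go (mkℚ ℤ.-[1+ _ ] _ _) record { pos = () }
    go γ@(mkℚ (ℤ.+ suc a) d _) _ = d , toℚᵘ-cancel-≤ (begin
      toℚᵘ 1ℚ                                      ≤⟨ *≤* (ℤ.+≤+ ineq) ⟩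
      mkℚᵘ (ℤ.+ suc a) d ℚᵘ.* mkℚᵘ (ℤ.+ suc d) 0   ≃⟨ ℚᵘ.*-congˡ {toℚᵘ γ} (toℚᵘ-ι (suc d)) ⟨
      toℚᵘ γ ℚᵘ.* toℚᵘ (ι (suc d))                 ≃⟨ toℚᵘ-homo-* γ (ι (suc d)) ⟨
      toℚᵘ (γ * ι (suc d))                         ∎)
      where
      open ℚᵘ.≤-Reasoning
      ineq : suc d ℕ.* 1 ℕ.+ 0 ℕ.≤ suc a ℕ.* suc d ℕ.* 1
      ineq = ℕ.≤-trans (ℕ.≤-reflexive (trans (ℕ.+-identityʳ _) (ℕ.*-identityʳ (suc d))))
        (ℕ.≤-trans (ℕ.m≤n*m (suc d) (suc a)) (ℕ.≤-reflexive (sym (ℕ.*-identityʳ _))))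

  -- Multiplied by 4q, the left side is qdn - 8qn + qdn(γ - e). Of the 2γ contained in e, one γ
  -- covers the loss of 1/q; the other pays for the extra summand ¼γdn, which becomes the gap of a
  -- strict inequality.
  slack : ∀ γ e q d n k → 0ℚ ≤ d → 0ℚ ≤ n → 0ℚ < q → γ + γ ≤ e → 1ℚ ≤ γ * q →
    q * d * n ≤ ι 4 * q * k + ι 8 * q * n + d * n →
    (ℤ.+ 1 / 4) * ((1ℚ - e) * d - ι 8) * n + (ℤ.+ 1 / 4) * (γ * (d * n)) ≤ k
  slack γ e q d n k 0≤d 0≤n q>0 2γ≤e 1≤γq h = *-cancelˡ-≤-pos (ι 4 * q) {{positive (*-pos (positive⁻¹ (ι 4)) q>0)}} (begin
    ι 4 * q * ((ℤ.+ 1 / 4) * ((1ℚ - e) * d - ι 8) * n + (ℤ.+ 1 / 4) * (γ * (d * n)))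
      ≡⟨ solve 5 (λ γ e q d n → con (ι 4) :* q :* (con (ℤ.+ 1 / 4) :* ((con 1ℚ :- e) :* d :- con (ι 8)) :* n :+ con (ℤ.+ 1 / 4) :* (γ :* (d :* n)))
           := q :* d :* n :- con (ι 8) :* q :* n :+ q :* (d :* n) :* (γ :- e)) refl γ e q d n ⟩
    q * d * n - ι 8 * q * n + q * (d * n) * (γ - e)
      ≤⟨ +-monoʳ-≤ (q * d * n - ι 8 * q * n) (*-monoˡ-≤-nonNeg (q * (d * n)) {{nonNegative qdn≥0}} γ-e≤-γ) ⟩
    q * d * n - ι 8 * q * n + q * (d * n) * - γ
      ≡⟨ solve 4 (λ γ q d n → q :* d :* n :- con (ι 8) :* q :* n :+ q :* (d :* n) :* :- γ
           := q :* d :* n :+ (:- (con (ι 8) :* q :* n) :- (d :* n) :* (γ :* q))) refl γ q d n ⟩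
    q * d * n + (- (ι 8 * q * n) - (d * n) * (γ * q))
      ≤⟨ +-mono-≤ h (+-monoʳ-≤ (- (ι 8 * q * n)) (neg-antimono-≤ (*-monoˡ-≤-nonNeg (d * n) {{nonNegative dn≥0}} 1≤γq))) ⟩
    ι 4 * q * k + ι 8 * q * n + d * n + (- (ι 8 * q * n) - (d * n) * 1ℚ)
      ≡⟨ solve 4 (λ q d n k → con (ι 4) :* q :* k :+ con (ι 8) :* q :* n :+ d :* n :+ (:- (con (ι 8) :* q :* n) :- (d :* n) :* con 1ℚ)
           := con (ι 4) :* q :* k) refl q d n k ⟩
    ι 4 * q * k ∎)
    where
    open ≤-Reasoning
    open +-*-Solver
    *-nonNeg : ∀ {x y} → 0ℚ ≤ x → 0ℚ ≤ y → 0ℚ ≤ x * y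
    *-nonNeg {x} {y} 0≤x 0≤y = nonNegative⁻¹ (x * y) {{nonNeg*nonNeg⇒nonNeg x {{nonNegative 0≤x}} y {{nonNegative 0≤y}}}}
    dn≥0 = *-nonNeg 0≤d 0≤n
    qdn≥0 = *-nonNeg (<⇒≤ q>0) dn≥0
    γ-e≤-γ : γ - e ≤ - γ
    γ-e≤-γ = subst (γ - e ≤_) (solve 1 (λ γ → γ :- (γ :+ γ) := :- γ) refl γ)
      (+-monoʳ-≤ γ (neg-antimono-≤ 2γ≤e))

-- The slope parameter bound over the reals

open import Defs
open import Data.Integer.Base using (+_)
open import Data.Nat.Base as ℕ using (ℕ)
open import Data.Nat.Divisibility.Core using (_∣_)
open import Data.Product.Base using (Σ-syntax; ∃-syntax; _×_; _,_)
import Data.Nat.Properties as ℕ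
open import Data.Rational.Base as ℚ using (ℚ; 0ℚ; 1ℚ; ½; _/_)
import Data.Rational.Properties as ℚ
open import Relation.Binary.PropositionalEquality using (_≡_; refl; sym; trans; cong; cong₂; subst; subst₂)
open import Relation.Nullary.Negation using (¬_)

open Sequences using (half-pos; half+half; *-pos)
open Counting using (Admissible; decompose; c; threshold)
open Escape using (manySlopes)
open Rationals

ι-inadmissible : ∀ Δ q n k → ¬ Admissible Δ q n k →
  ι q ℚ.* ι Δ ℚ.* ι n ℚ.≤ ι 4 ℚ.* ι q ℚ.* ι k ℚ.+ ι 8 ℚ.* ι q ℚ.* ι n ℚ.+ ι Δ ℚ.* ι n
ι-inadmissible Δ q n k ¬adm = subst₂ ℚ._≤_ (ι-*-* q Δ n)
  (trans (ι-+ (4 ℕ.* q ℕ.* k ℕ.+ 8 ℕ.* q ℕ.* n) (Δ ℕ.* n))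
    (cong₂ ℚ._+_ (trans (ι-+ (4 ℕ.* q ℕ.* k) (8 ℕ.* q ℕ.* n)) (cong₂ ℚ._+_ (ι-*-* 4 q k) (ι-*-* 8 q n))) (ι-* Δ n)))
  (ι-mono-≤ (ℕ.≮⇒≥ ¬adm))
  where
  ι-*-* : ∀ a b c → ι (a ℕ.* b ℕ.* c) ≡ ι a ℚ.* ι b ℚ.* ι c
  ι-*-* a b c = trans (ι-* (a ℕ.* b) c) (cong (ℚ._* ι c) (ι-* a b))

-- A strict inequality of reals requires a positive rational gap, here the extra summand of `slack`;
-- it is positive because Δ and n are.
inadmissible⇒< : ∀ Δ q n k ε γ → 0ℚ ℚ.< γ → 1 ℕ.≤ Δ → 1 ℕ.≤ n → 1ℚ ℚ.≤ γ ℚ.* ι (ℕ.suc q) →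
  ∃[ N ] (∀ {i} → N ℕ.≤ i → γ ℚ.+ γ ℚ.≤ ℝ.seq ε i) → ¬ Admissible Δ (ℕ.suc q) n k →
  fromℚ (+ 1 / 4) * ((1ℝ - ε) * fromℕ Δ - fromℕ 8) * fromℕ n < fromℕ k
inadmissible⇒< Δ q n k ε γ γ>0 1≤Δ 1≤n 1≤γq (N , 2γ≤ε) ¬adm = mk<
  ((+ 1 / 4) ℚ.* (γ ℚ.* (ι Δ ℚ.* ι n)))
  (*-pos (ℚ.positive⁻¹ (+ 1 / 4)) (*-pos γ>0 (*-pos (ι-pos {Δ} 1≤Δ) (ι-pos {n} 1≤n))))
  (N , λ {i} N≤i → slack γ (ℝ.seq ε i) (ι (ℕ.suc q)) (ι Δ) (ι n) (ι k)
    (ι-mono-≤ {0} {Δ} ℕ.z≤n) (ι-mono-≤ {0} {n} ℕ.z≤n) (ι-pos {ℕ.suc q} (ℕ.s≤s ℕ.z≤n)) (2γ≤ε N≤i) 1≤γq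
    (ι-inadmissible Δ (ℕ.suc q) n k ¬adm))

theorem6 : (Δ : ℕ) (ε : ℝ) → 9 ℕ.≤ Δ → 0ℝ < ε →
    Σ[ n₀ ∈ ℕ ] ((n : ℕ) → n₀ ℕ.< n → 2 ∣ Δ ℕ.* n →
    Σ[ G ∈ Graph n ] (Regular Δ G ×
    ((k : ℕ) → IsSlopeParameter G k →
    fromℚ (+ 1 / 4) * ((1ℝ - ε) * fromℕ Δ - fromℕ 8) * fromℕ n < fromℕ k)))
-- Eventually ε is at least `g`. With γ = g/2, one half serves to choose q such that 1/(q+1) ≤ γ,
-- and the other is kept for the gap.
theorem6 Δ ε 9≤Δ (mk< g g>0 (N , g≤ε)) with archimedean (g ℚ.* ½) (half-pos g>0)
... | q , 1≤γq = n₀ , λ n n₀<n 2∣Δn →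
    let G , G-regular , many = graph n n₀<n 2∣Δn
    in  G , G-regular , λ k (representation , _) → inadmissible⇒< Δ q n k ε (g ℚ.* ½) (half-pos g>0)
          1≤Δ (ℕ.≤-trans (ℕ.s≤s ℕ.z≤n) n₀<n) 1≤γq (N , 2γ≤ε) (many k representation)
  where
  -- The first summand is what `decompose` requires. The second forces `threshold` below m, because
  -- n ≤ 2Δ(m+c).
  n₀ : ℕ
  n₀ = 2 ℕ.* Δ ℕ.* (2 ℕ.* Δ) ℕ.+ 2 ℕ.* Δ ℕ.* (threshold Δ q ℕ.+ c Δ q)
  1≤Δ : 1 ℕ.≤ Δ
  1≤Δ = ℕ.≤-trans (ℕ.s≤s ℕ.z≤n) 9≤Δ
  2γ≤ε : ∀ {i} → N ℕ.≤ i → g ℚ.* ½ ℚ.+ g ℚ.* ½ ℚ.≤ ℝ.seq ε i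
  2γ≤ε N≤i = subst (ℚ._≤ _) (trans (ℚ.+-identityˡ g) (sym (half+half g))) (g≤ε N≤i)
  graph : ∀ n → n₀ ℕ.< n → 2 ∣ Δ ℕ.* n → Σ[ G ∈ Graph n ] (Regular Δ G ×
    (∀ k → Representable G k → ¬ Admissible Δ (ℕ.suc q) n k))
  graph n n₀<n 2∣Δn with decompose Δ n 1≤Δ 2∣Δn (ℕ.<⇒≤ (ℕ.≤-<-trans (ℕ.m≤m+n _ _) n₀<n))
  ... | m , j , refl , n≤ = manySlopes Δ q m j 1≤Δ (ℕ.≤-trans (ℕ.s≤s ℕ.z≤n) n₀<n) n≤ large
    where
    large : threshold Δ q ℕ.≤ m
    large = ℕ.<⇒≤ (ℕ.+-cancelʳ-< (c Δ q) (threshold Δ q) m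
      (ℕ.*-cancelˡ-< (2 ℕ.* Δ) (threshold Δ q ℕ.+ c Δ q) (m ℕ.+ c Δ q)
        (ℕ.<-≤-trans (ℕ.≤-<-trans (ℕ.m≤n+m _ (2 ℕ.* Δ ℕ.* (2 ℕ.* Δ))) n₀<n) n≤)))
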